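{- Let $n\ge 2$. For every $T\in\underline{\mathcal E}_n$, the sequence $\mathsf r^T$ is a tree-like factorization of $\lambda_n$, and the map $T\mapsto \mathsf r^T$ is a bijection from $\underline{\mathcal E}_n$ onto the set $\underline{\mathrm{FACT}}_n$ of all tree-like factorizations of $\lambda_n$.
   Context: $\widetilde S_n$ is the affine symmetric group: the group of bijections $w:\mathbb Z\to\mathbb Z$ with $w(i+n)=w(i)+n$ for all $i$ and $\sum_{i=1}^n w(i)=\binom{n+1}{2}$, multiplied by composition $(vw)(k)=v(w(k))$. For $i,j\in\mathbb Z$ with $i\not\equiv j\pmod n$, the affine reflection $(\!(i,j)\!)$ interchanges $i+kn$ and $j+kn$ for every $k\in\mathbb Z$ and fixes all other integers; thus $(\!(i,j)\!)=(\!(j,i)\!)=(\!(i+kn,j+kn)\!)$. Let $\lambda_n\in\widetilde S_n$ be given by $\lambda_n(k)=k+n$ if $k\not\equiv0\pmod n$ and $\lambda_n(k)=k-n(n-1)$ if $k\equiv 0\pmod n$. Its reflection length is $2n-2$. A minimal length reflection factorization of $\lambda_n$ is a sequence $[r_1,\dots,r_{2n-2}]$ of affine reflections with $r_1r_2\cdots r_{2n-2}=\lambda_n$; it is tree-like if there exist integers $a_0,\dots,a_{2n-3},b_1,\dots,b_{2n-2}$ with $r_k=(\!(a_{k-1},b_k)\!)$ and $a_{k-1}<b_k$ for $1\le k\le 2n-2$, and $a_k\equiv b_k\pmod n$ for $1\le k\le 2n-3$. $\underline{\mathcal E}_n$ is the set of plane-embedded trees with vertex set $[n]=\{1,\dots,n\}$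 together with a marked edge incident to vertex $n$, considered up to orientation-preserving homeomorphism of the plane (preserving labels and marked edge). For $T\in\underline{\mathcal E}_n$, walk around $T$ clockwise starting at vertex $n$, first traversing the marked edge (after arriving at a vertex $v$ along an edge $e$, leave $v$ along the edge following $e$ in clockwise order around $v$), so that every edge is traversed exactly twice and the walk ends at $n$; let $v_0=n,v_1,\dots,v_{2n-2}=n$ be the successive vertices visited. Then $\mathsf r^T=[r_1,\dots,r_{2n-2}]$ where $r_k=(\!(v_{k-1},v_k)\!)$ if $v_{k-1}<v_k$ and $r_k=(\!(v_{k-1}-n,v_k)\!)$ if $v_{k-1}>v_k$. -}

module Defs where

open import Data.Nat using (ℕ; zero; suc; _∸_; _≤_) renaming (_*_ to _*ℕ_; _+_ to _+ℕ_)
open import Data.Nat.Divisibility using (_∣_; _∣?_)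
import Data.Integer as ℤ
open ℤ using (ℤ; +_)
import Data.Integer.Properties as ℤP
open import Data.Fin using (Fin; toℕ) renaming (_≟_ to _≟ᶠ_)
open import Data.List using (List; []; _∷_; _++_; drop; take; length; map)
open import Data.Nat.ListAction using (sum)
open import Data.List.Membership.Propositional using (_∈_; _∉_)
open import Data.List.Relation.Unary.Unique.Propositional using (Unique)
open import Data.Vec using (Vec; []; _∷_; tabulate; lookup)
open import Data.Vec.Relation.Binary.Pointwise.Inductive using (Pointwise)
open import Data.Maybe using (Maybe; just; nothing; fromMaybe)
open import Data.Product using (Σ; ∃; _×_; _,_; proj₁; proj₂)
open import Data.Bool using (if_then_else_)
open import Relation.Nullary using (¬_; does)
open import Relation.Binary.PropositionalEquality using (_≡_)

Cong : ℕ → ℤ → ℤ → Set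
Cong n a b = n ∣ ℤ.∣ a ℤ.- b ∣

-- An affine reflection ((i,j)) is represented by a pair (i , j) of integers
-- with i ≢ j (mod n).
Pair : Set
Pair = ℤ × ℤ

IsRefl : ℕ → Pair → Set
IsRefl n (i , j) = ¬ Cong n i j

-- The bijection ℤ → ℤ given by ((i,j)): swaps i+kn and j+kn for all k.
act : ℕ → Pair → ℤ → ℤ
act n (i , j) k =
  if does (n ∣? ℤ.∣ k ℤ.- i ∣) then k ℤ.- i ℤ.+ j
  else (if does (n ∣? ℤ.∣ k ℤ.- j ∣) then k ℤ.- j ℤ.+ i else k)

-- Equality of affine reflections as elements of the affine symmetric group
-- (equality of the underlying bijections of ℤ).
_≈ᵣ[_]_ : Pair → ℕ → Pair → Set
r ≈ᵣ[ n ] s = ∀ k → act n r k ≡ act n s k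

prod : ℕ → {m : ℕ} → Vec Pair m → ℤ → ℤ
prod n []       k = k
prod n (r ∷ rs) k = act n r (prod n rs k)

lam : ℕ → ℤ → ℤ
lam n k = if does (n ∣? ℤ.∣ k ∣) then k ℤ.- (+ (n *ℕ (n ∸ 1))) else k ℤ.+ (+ n)

L : ℕ → ℕ
L n = 2 *ℕ n ∸ 2

IsMinFact : (n : ℕ) → Vec Pair (L n) → Set
IsMinFact n rs = (∀ (i : Fin (L n)) → IsRefl n (lookup rs i))
               × (∀ k → prod n rs k ≡ lam n k)

-- tree-like: r_k = ((a_{k-1}, b_k)), a_{k-1} < b_k (1 ≤ k ≤ 2n-2),
-- a_k ≡ b_k mod n (1 ≤ k ≤ 2n-3).  Entry i : Fin (L n) of the vector is r_{i+1}.
IsTreeLike : (n : ℕ) → Vec Pair (L n) → Set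
IsTreeLike n rs =
  Σ (ℕ → ℤ) λ a → Σ (ℕ → ℤ) λ b →
    (∀ (i : Fin (L n)) →
        IsRefl n (a (toℕ i) , b (suc (toℕ i)))
      × (lookup rs i ≈ᵣ[ n ] (a (toℕ i) , b (suc (toℕ i))))
      × (a (toℕ i) ℤ.< b (suc (toℕ i))))
  × (∀ k → 1 ≤ k → k ≤ 2 *ℕ n ∸ 3 → Cong n (a k) (b k))

FACT : (n : ℕ) → Vec Pair (L n) → Set
FACT n rs = IsMinFact n rs × IsTreeLike n rs

_≋[_]_ : {m : ℕ} → Vec Pair m → ℕ → Vec Pair m → Set
rs ≋[ n ] ss = Pointwise (λ r s → r ≈ᵣ[ n ] s) rs ss

-- Plane trees on [n] with a marked edge at n, as rotation systems.
-- Vertex v : Fin n carries label toℕ v + 1.  ρ v lists the neighbours of v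
-- in clockwise order (a cyclic order, hence only defined up to rotation).

module _ {n : ℕ} (ρ : Fin n → List (Fin n)) where
  data Path : Fin n → Fin n → Set where
    here  : ∀ {v} → Path v v
    there : ∀ {u w v} → w ∈ ρ u → Path w v → Path u v

record PlaneTree (n : ℕ) : Set where
  field
    ρ         : Fin n → List (Fin n)
    nodup     : ∀ v → Unique (ρ v)
    noloop    : ∀ v → v ∉ ρ v
    symm      : ∀ u v → u ∈ ρ v → v ∈ ρ u
    nEdges    : sum (map (λ v → length (ρ v)) (Data.List.allFin n)) ≡ 2 *ℕ (n ∸ 1)
    connected : ∀ u v → Path ρ u v
    root      : Fin n
    rootIsN   : suc (toℕ root) ≡ n
    mark      : Fin n          -- the marked edge is {root , mark}
    markAdj   : mark ∈ ρ root

IsRotation : {A : Set} → List A → List A → Set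
IsRotation xs ys = ∃ λ k → ys ≡ drop k xs ++ take k xs

-- orientation-preserving homeomorphism class (labels and marked edge preserved)
_∼_ : {n : ℕ} → PlaneTree n → PlaneTree n → Set
T ∼ T' = (∀ v → IsRotation (PlaneTree.ρ T v) (PlaneTree.ρ T' v))
       × (PlaneTree.mark T ≡ PlaneTree.mark T')

module _ {n : ℕ} where
  private
    succAux : Fin n → List (Fin n) → Fin n → Maybe (Fin n)
    succAux h []           p = nothing
    succAux h (x ∷ [])     p = if does (x ≟ᶠ p) then just h else nothing
    succAux h (x ∷ y ∷ ys) p = if does (x ≟ᶠ p) then just y else succAux h (y ∷ ys) p

  -- the element following p in the cyclic list xs (p itself if p ∉ xs)
  nextCW : List (Fin n) → Fin n → Fin n
  nextCW []       p = p
  nextCW (x ∷ xs) p = fromMaybe p (succAux x (x ∷ xs) p)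

-- walkState T k = (v_k , v_{k+1})
walkState : {n : ℕ} → PlaneTree n → ℕ → Fin n × Fin n
walkState T zero = PlaneTree.root T , PlaneTree.mark T
walkState T (suc k) with walkState T k
... | p , c = c , nextCW (PlaneTree.ρ T c) p

label : {n : ℕ} → Fin n → ℤ
label v = + suc (toℕ v)

stepRefl : (n : ℕ) → Fin n → Fin n → Pair
stepRefl n p c = if does (label p ℤP.<? label c) then (label p , label c)
                 else (label p ℤ.- (+ n) , label c)

rT : {n : ℕ} → PlaneTree n → Vec Pair (L n)
rT {n} T = tabulate λ i → let s = walkState T (toℕ i) in stepRefl n (proj₁ s) (proj₂ s)

{-# OPTIONS --safe #-}
module Submission where

-- Reading a product of reflections ((a , b)) with a < b from right to left, the tree-like condition
-- says that a token starts at the class of the last b and walks through the classes, always moving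
-- down; each factor pushes the particle met by the token up to the class the token leaves.  If the
-- product is λₙ, the token sits in class 0 and each of the n - 1 other particles rises by n.  Since a
-- move changes the class, each particle moves at least twice, and there are only 2n - 2 moves, so each
-- moves exactly twice: the particle v goes to some class j and comes back.  Hence the walk first
-- reaches v from j, finally leaves v to j, and does not visit j in between, i.e. it is the tour
-- of a plane tree, whose rotation system lists the exits from each vertex in order of time.
-- Conversely, in a plane tree every edge is a bridge, so the periodic walk crosses each edge it
-- crosses in both directions; its darts are thus closed under reversal and rotation, so the walk
-- visits all 2n - 2 darts once, and the particles of the resulting product move as above.

-- Both directions pass through one notion, `Tour`: a closed sequence of vertices with an excursion
-- for each vertex but the root. A factorization yields one by counting moves, a tree by its walk.
-- The classes joined by a reflection determine its shift only modulo `n`. What pins it down is that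
-- the rise by `n` of a particle splits into two positive shifts, so each is below `n`, and
-- `stepRefl` is the reflection with given classes and a shift in that range. Conversely, shifts
-- below `n` across an edge in both directions add up to `n`, and the `n - 1` particles account for
-- the drop by `n(n - 1)` in class 0. A `PlaneTree` offers connectedness and a count of darts, but
-- no parents. Distances to the root supply them, and the count leaves no room for further edges.
-- The walk is periodic because each turn can be undone. Its period is unknown at first, so the
-- visited darts are studied for an arbitrary period `p`, which gives `2(n - 1) <= p`; the
-- pigeonhole principle gives a period of at most `2(n - 1)`.

open import Defs
open import Data.Bool using (if_then_else_; true; false)
open import Data.Empty using (⊥; ⊥-elim; ⊥-elim-irr)
open import Data.Fin using (Fin; zero; suc; toℕ; fromℕ<; remQuot; combine) renaming (_≟_ to _≟ᶠ_; _<_ to _<ᶠ_)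
import Data.Fin.Properties as FinP
open import Data.Integer as ℤ using (ℤ; +_; ∣_∣)
import Data.Integer.DivMod as ℤD
import Data.Integer.Divisibility.Signed as S
import Data.Integer.Properties as ℤP
open import Algebra.Properties.AbelianGroup ℤP.+-0-abelianGroup using () renaming (∙-cancelˡ to +-cancelˡ)
open import Data.Integer.Tactic.RingSolver using (solve-∀)
open import Data.List using (List; []; _∷_; [_]; _++_; take; drop; map; length; concatMap; allFin) renaming (tabulate to tabulateᴸ; lookup to lookupᴸ)
import Data.List.Properties as List
open import Data.List.Membership.Propositional using (_∈_; _∉_; lose; find)
open import Data.List.Membership.Propositional.Properties using (∈-++⁻; ∈-∃++; ∈-lookup; ∈-concatMap⁺; ∈-map⁺; ∈-allFin)
open import Data.List.Relation.Unary.All using ([]; _∷_)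
open import Data.List.Relation.Unary.All.Properties using (All¬⇒¬Any; ¬Any⇒All¬)
open import Data.List.Relation.Unary.AllPairs using ([]; _∷_)
open import Data.List.Relation.Unary.Any using (Any; here; there; index; any?)
open import Data.List.Relation.Unary.Any.Properties using (lookup-index)
open import Data.List.Relation.Unary.Unique.Propositional using (Unique)
open import Data.Maybe using (Maybe; just; fromMaybe)
open import Data.Nat as ℕ using (ℕ; zero; suc; _+_; _*_; _≤_; _<_; _∸_; z≤n; s≤s)
open import Data.Nat.Divisibility using (_∣_; divides; _∣?_; ∣⇒≤)
open import Data.Nat.DivMod using (_%_; _/_; m≡m%n+[m/n]*n; m%n<n)
open import Data.Nat.ListAction using (sum)
import Data.Nat.Properties as ℕP
import Data.Nat.Tactic.RingSolver as ℕSolver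
open import Data.Product using (Σ; ∃; ∃₂; _×_; _,_; proj₁; proj₂; uncurry)
open import Data.Sum using (_⊎_; inj₁; inj₂)
open import Data.Vec using (Vec; []; _∷_; lookup)
import Data.Vec.Properties as Vec
open import Data.Vec.Relation.Binary.Pointwise.Inductive using (tabulate⁺; tabulate⁻)
open import Function using (_∘_)
open import Relation.Binary using (tri<; tri≈; tri>)
open import Relation.Binary.PropositionalEquality using (_≡_; _≢_; refl; sym; trans; cong; cong₂; subst)
open import Relation.Nullary using (¬_; Dec; yes; no; does; contradiction)
open import Relation.Nullary.Decidable using (dec-true; dec-false; map′; _⊎-dec_; _×-dec_; ¬?)

-- Cyclic orders

data Consec {A : Set} (p q : A) : List A → Set where
  here  : ∀ {l} → Consec p q (p ∷ q ∷ l)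
  there : ∀ {x l} → Consec p q l → Consec p q (x ∷ l)

-- Appending a copy of the head makes the cyclic order linear; the sole element of a one-element
-- list succeeds itself, as it does for `nextCW`.
CycNext : {A : Set} → A → A → List A → Set
CycNext p q xs = Consec p q (xs ++ take 1 xs)

consec-∈ˡ : ∀ {A : Set} {p q : A} l h → Consec p q (l ++ [ h ]) → p ∈ l
consec-∈ˡ [] h (there ())
consec-∈ˡ (x ∷ []) h here = here refl
consec-∈ˡ (x ∷ y ∷ l) h here = here refl
consec-∈ˡ (x ∷ l) h (there c) = there (consec-∈ˡ l h c)

if-true : {P A : Set} (d : Dec P) {x y : A} → P → (if does d then x else y) ≡ x
if-true d p rewrite dec-true d p = refl

if-false : {P A : Set} (d : Dec P) {x y : A} → ¬ P → (if does d then x else y) ≡ y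
if-false d ¬p rewrite dec-false d ¬p = refl

-- The successor search behind nextCW is private to Defs; unification recovers it.
succSearch : ∀ {n} → Σ (Fin n → Fin n → List (Fin n) → Fin n → Maybe (Fin n)) λ g →
  ∀ x y ys p → nextCW (x ∷ y ∷ ys) p ≡ fromMaybe p (if does (x ≟ᶠ p) then just y else g x y ys p)
succSearch = _ , λ x y ys p → refl

succ-consec : ∀ {n} (h x : Fin n) xs {p q} → Unique (x ∷ xs) → Consec p q (x ∷ xs ++ [ h ]) →
  proj₁ succSearch h x xs p ≡ just q
succ-consec h x [] u here = if-true (x ≟ᶠ x) refl
succ-consec h x [] u (there (there ()))
succ-consec h x (y ∷ ys) u here = if-true (x ≟ᶠ x) refl
succ-consec h x (y ∷ ys) {p} (x∉ ∷ u) (there c) =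
  trans (if-false (x ≟ᶠ p) λ { refl → All¬⇒¬Any x∉ (consec-∈ˡ (y ∷ ys) h c) }) (succ-consec h y ys u c)

nextCW-cycNext : ∀ {n} (xs : List (Fin n)) {p q} → Unique xs → CycNext p q xs → nextCW xs p ≡ q
nextCW-cycNext (x ∷ []) u here rewrite dec-true (x ≟ᶠ x) refl = refl
nextCW-cycNext (x ∷ []) u (there (there ()))
nextCW-cycNext (x ∷ y ∷ ys) u c rewrite succ-consec x x (y ∷ ys) u c = refl

module _ {A : Set} where

  consec-∈ʳ : ∀ {p q x : A} {l} → Consec p q (x ∷ l) → q ∈ l
  consec-∈ʳ here = here refl
  consec-∈ʳ {l = _ ∷ _} (there c) = there (consec-∈ʳ c)

  consec-∃ : ∀ {p : A} l h → p ∈ l → ∃ λ q → Consec p q (l ++ [ h ])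
  consec-∃ (x ∷ []) h (here refl) = h , here
  consec-∃ (x ∷ y ∷ l) h (here refl) = y , here
  consec-∃ (x ∷ l) h (there p∈) = let q , c = consec-∃ l h p∈ in q , there c

  cycNext-∃ : ∀ {p : A} xs → p ∈ xs → ∃ λ q → CycNext p q xs
  cycNext-∃ (x ∷ xs) p∈ = consec-∃ (x ∷ xs) x p∈

  cycNext-∈ˡ : ∀ {p q : A} xs → CycNext p q xs → p ∈ xs
  cycNext-∈ˡ (x ∷ xs) c = consec-∈ˡ (x ∷ xs) x c

  ∈-snoc : ∀ {x y : A} xs → x ∈ xs ++ [ y ] → x ∈ y ∷ xs
  ∈-snoc xs m with ∈-++⁻ xs m
  ... | inj₁ i = there i
  ... | inj₂ (here e) = here e

  cycNext-∈ʳ : ∀ {p q : A} xs → CycNext p q xs → q ∈ xs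
  cycNext-∈ʳ (x ∷ xs) c = ∈-snoc xs (consec-∈ʳ c)

  unique-snoc : ∀ {x : A} xs → Unique (x ∷ xs) → Unique (xs ++ [ x ])
  unique-snoc [] u = [] ∷ []
  unique-snoc {x} (y ∷ ys) ((x≢y ∷ x∉) ∷ (y∉ ∷ u)) =
    ¬Any⇒All¬ _ (λ m → lem (∈-snoc ys m)) ∷ unique-snoc ys (x∉ ∷ u)
    where
    lem : y ∉ x ∷ ys
    lem (here e) = x≢y (sym e)
    lem (there m) = All¬⇒¬Any y∉ m

  consec-injective : ∀ {p p′ q x : A} {l} → Unique l → Consec p q (x ∷ l) → Consec p′ q (x ∷ l) → p ≡ p′
  consec-injective u here here = refl
  consec-injective (q∉ ∷ u) here (there c) = contradiction (consec-∈ʳ c) (All¬⇒¬Any q∉)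
  consec-injective (q∉ ∷ u) (there c) here = contradiction (consec-∈ʳ c) (All¬⇒¬Any q∉)
  consec-injective (q∉ ∷ u) (there c) (there c′) = consec-injective u c c′

  cycNext-injective : ∀ {p p′ q : A} xs → Unique xs → CycNext p q xs → CycNext p′ q xs → p ≡ p′
  cycNext-injective (x ∷ xs) u = consec-injective (unique-snoc xs u)

  consec-split⁻ : ∀ {p q x : A} l r → Consec p q (l ++ x ∷ r) → Consec p q (l ++ [ x ]) ⊎ Consec p q (x ∷ r)
  consec-split⁻ [] r c = inj₂ c
  consec-split⁻ (y ∷ []) r here = inj₁ here
  consec-split⁻ (y ∷ z ∷ l) r here = inj₁ here
  consec-split⁻ (y ∷ l) r (there c) with consec-split⁻ l r c
  ... | inj₁ c′ = inj₁ (there c′)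
  ... | inj₂ c′ = inj₂ c′

  consec-++⁺ʳ : ∀ {p q : A} l {r} → Consec p q r → Consec p q (l ++ r)
  consec-++⁺ʳ [] c = c
  consec-++⁺ʳ (x ∷ l) c = there (consec-++⁺ʳ l c)

  consec-++⁺ˡ : ∀ {p q x : A} l r → Consec p q (l ++ [ x ]) → Consec p q (l ++ x ∷ r)
  consec-++⁺ˡ [] r (there ())
  consec-++⁺ˡ (y ∷ []) r here = here
  consec-++⁺ˡ (y ∷ z ∷ l) r here = here
  consec-++⁺ˡ (y ∷ l) r (there c) = there (consec-++⁺ˡ l r c)

  -- An adjacency in the closed-up list lies either before the head `b` of the second block, with
  -- `b` included, or from `b` on; swapping the blocks exchanges these two halves.
  cycNext-++-comm : ∀ {p q : A} as bs → CycNext p q (as ++ bs) → CycNext p q (bs ++ as)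
  cycNext-++-comm [] bs c rewrite List.++-identityʳ bs = c
  cycNext-++-comm (a ∷ as) [] c rewrite List.++-identityʳ as = c
  cycNext-++-comm (a ∷ as) (b ∷ bs) c
    rewrite List.++-assoc as (b ∷ bs) [ a ] | List.++-assoc bs (a ∷ as) [ b ]
    with consec-split⁻ (a ∷ as) (bs ++ [ a ]) c
  ... | inj₁ c′ = consec-++⁺ʳ (b ∷ bs) c′
  ... | inj₂ c′ = consec-++⁺ˡ (b ∷ bs) (as ++ [ b ]) c′

  unique-++-comm : ∀ (as bs : List A) → Unique (as ++ bs) → Unique (bs ++ as)
  unique-++-comm [] bs u rewrite List.++-identityʳ bs = u
  unique-++-comm (a ∷ as) bs u =
    subst Unique (List.++-assoc bs [ a ] as)
      (unique-++-comm as (bs ++ [ a ]) (subst Unique (List.++-assoc as bs [ a ]) (unique-snoc (as ++ bs) u)))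

  -- From `p` the property runs to the copy of the head at the end, and then from the head through
  -- the whole list.
  cycNext-covers : ∀ (S : A → Set) xs → (∀ p q → CycNext p q xs → S p → S q) →
    ∀ {p} → p ∈ xs → S p → ∀ {q} → q ∈ xs → S q
  cycNext-covers S (x ∷ xs) cl p∈ Sp q∈ = fromHead x xs cl (toEnd (x ∷ xs) cl p∈ Sp) q∈
    where
    toEnd : ∀ l {h} → (∀ p q → Consec p q (l ++ [ h ]) → S p → S q) → ∀ {p} → p ∈ l → S p → S h
    toEnd (y ∷ []) cl (here refl) Sp = cl _ _ here Sp
    toEnd (y ∷ z ∷ l) cl (here refl) Sp = toEnd (z ∷ l) (λ p q c → cl p q (there c)) (here refl) (cl _ _ here Sp)
    toEnd (y ∷ z ∷ l) cl (there m) Sp = toEnd (z ∷ l) (λ p q c → cl p q (there c)) m Sp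
    fromHead : ∀ y l {h} → (∀ p q → Consec p q (y ∷ l ++ [ h ]) → S p → S q) → S y → ∀ {q} → q ∈ y ∷ l → S q
    fromHead y l cl Sy (here refl) = Sy
    fromHead y (z ∷ l) cl Sy (there m) = fromHead z l (λ p q c → cl p q (there c)) (cl _ _ here Sy) m

  -- `x` serves as an end marker: it occurs in neither list, so equal successors also force both to
  -- stop at the same place.
  consec-functional⇒≡ : ∀ {x y : A} u w → x ∉ u → x ∉ w →
    (∀ {p q q′} → Consec p q (y ∷ u ++ [ x ]) → Consec p q′ (y ∷ w ++ [ x ]) → q ≡ q′) → u ≡ w
  consec-functional⇒≡ [] [] x∉u x∉w f = refl
  consec-functional⇒≡ [] (b ∷ w) x∉u x∉w f = contradiction (here (f here here)) x∉w
  consec-functional⇒≡ (a ∷ u) [] x∉u x∉w f = contradiction (here (sym (f here here))) x∉u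
  consec-functional⇒≡ (a ∷ u) (b ∷ w) x∉u x∉w f with f here here
  ... | refl = cong (a ∷_) (consec-functional⇒≡ u w (x∉u ∘ there) (x∉w ∘ there) λ c c′ → f (there c) (there c′))

  take-++-length : ∀ (as : List A) {bs} → take (length as) (as ++ bs) ≡ as
  take-++-length [] = refl
  take-++-length (a ∷ as) = cong (a ∷_) (take-++-length as)

  drop-++-length : ∀ (as : List A) {bs} → drop (length as) (as ++ bs) ≡ bs
  drop-++-length [] = refl
  drop-++-length (a ∷ as) = drop-++-length as

  rotation-++ : ∀ (as bs : List A) → IsRotation (as ++ bs) (bs ++ as)
  rotation-++ as bs = length as , sym (cong₂ _++_ (drop-++-length as) (take-++-length as))

cycNext-nextCW : ∀ {n} (xs : List (Fin n)) {p} → Unique xs → p ∈ xs → CycNext p (nextCW xs p) xs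
cycNext-nextCW xs u p∈ =
  let q , c = cycNext-∃ xs p∈ in subst (λ z → CycNext _ z xs) (sym (nextCW-cycNext xs u c)) c

nextCW-∈ : ∀ {n} (xs : List (Fin n)) {p} → Unique xs → p ∈ xs → nextCW xs p ∈ xs
nextCW-∈ xs u p∈ = cycNext-∈ʳ xs (cycNext-nextCW xs u p∈)

nextCW-injective : ∀ {n} (xs : List (Fin n)) {p q} → Unique xs → p ∈ xs → q ∈ xs →
  nextCW xs p ≡ nextCW xs q → p ≡ q
nextCW-injective xs u p∈ q∈ e = cycNext-injective xs u (cycNext-nextCW xs u p∈)
  (subst (λ z → CycNext _ z xs) (sym e) (cycNext-nextCW xs u q∈))

nextCW-rotation : ∀ {n} (xs ys : List (Fin n)) {p} → Unique xs → IsRotation xs ys → p ∈ xs →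
  nextCW xs p ≡ nextCW ys p
nextCW-rotation xs ys {p} u (k , refl) p∈ = sym (nextCW-cycNext _
  (unique-++-comm (take k xs) (drop k xs) (subst Unique (sym eq) u))
  (cycNext-++-comm (take k xs) (drop k xs) (subst (CycNext p _) (sym eq) (cycNext-nextCW xs u p∈))))
  where
  eq : take k xs ++ drop k xs ≡ xs
  eq = List.take++drop≡id k xs

-- Cutting `ys` at the head of `xs` and swapping the pieces gives a list with that head; equal
-- successors then make the tails agree.
nextCW⇒rotation : ∀ {n} (xs ys : List (Fin n)) → Unique xs → Unique ys →
  (∀ {p} → p ∈ xs → p ∈ ys) → (∀ {p} → p ∈ ys → p ∈ xs) →
  (∀ {p} → p ∈ xs → nextCW xs p ≡ nextCW ys p) → IsRotation xs ys
nextCW⇒rotation [] [] ux uy to from f = 0 , refl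
nextCW⇒rotation [] (y ∷ ys) ux uy to from f with from (here refl)
... | ()
nextCW⇒rotation (x ∷ xs) ys ux uy to from f with ∈-∃++ (to (here refl))
... | as , bs , refl = subst (λ z → IsRotation (x ∷ z) _) (sym eq) (rotation-++ (x ∷ bs) as)
  where
  zs = x ∷ bs ++ as
  uz : Unique zs
  uz = unique-++-comm as (x ∷ bs) uy
  head∉ : ∀ {y} {l : List _} → Unique (y ∷ l) → y ∉ l
  head∉ (y∉ ∷ _) = All¬⇒¬Any y∉
  eq : xs ≡ bs ++ as
  eq = consec-functional⇒≡ xs (bs ++ as) (head∉ ux) (head∉ uz) λ {p} c c′ →
    trans (sym (nextCW-cycNext (x ∷ xs) ux c))
      (trans (f (cycNext-∈ˡ (x ∷ xs) c))
        (nextCW-cycNext _ uy (cycNext-++-comm (x ∷ bs) as c′)))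

consec-++⁺ : ∀ {A : Set} {p q : A} {l} r → Consec p q l → Consec p q (l ++ r)
consec-++⁺ r here = here
consec-++⁺ r (there c) = there (consec-++⁺ r c)

cycNext-wrap : ∀ {A : Set} {p q : A} {xs l l′} → xs ≡ q ∷ l → xs ≡ l′ ++ [ p ] → CycNext p q xs
cycNext-wrap {p = p} {q} {l′ = l′} refl e =
  subst (Consec p q) (trans (sym (List.++-assoc l′ [ p ] [ q ])) (cong (_++ [ q ]) (sym e))) (consec-++⁺ʳ l′ here)

-- Congruences and affine reflections

-- `Cong` computes to a divisibility from which `a` and `b` cannot be inferred; the record keeps
-- them as parameters.
record Congr (n : ℕ) (a b : ℤ) : Set where
  constructor congr
  field raw : Cong n a b

open Congr public

module _ {n : ℕ} where

  cong-intro : ∀ {a b} q → a ℤ.- b ≡ q ℤ.* + n → Congr n a b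
  cong-intro q e = congr (S.∣⇒∣ᵤ {+ n} (S.divides q e))

  cong-elim : ∀ {a b} → Congr n a b → ∃ λ q → a ℤ.- b ≡ q ℤ.* + n
  cong-elim (congr c) with S.∣ᵤ⇒∣ {+ n} c
  ... | S.divides q e = q , e

  cong-refl : ∀ {a} → Congr n a a
  cong-refl {a} = cong-intro (+ 0) (ℤP.+-inverseʳ a)

  cong-reflexive : ∀ {a b} → a ≡ b → Congr n a b
  cong-reflexive refl = cong-refl

  cong-sym : ∀ {a b} → Congr n a b → Congr n b a
  cong-sym {a} {b} c with cong-elim c
  ... | q , e = cong-intro (ℤ.- q) (trans (lem a b) (trans (cong ℤ.-_ e) (ℤP.neg-distribˡ-* q (+ n))))
    where
    lem : ∀ a b → b ℤ.- a ≡ ℤ.- (a ℤ.- b)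
    lem = solve-∀

  cong-trans : ∀ {a b c} → Congr n a b → Congr n b c → Congr n a c
  cong-trans {a} {b} {c} p p′ with cong-elim p | cong-elim p′
  ... | q , e | q′ , e′ = cong-intro (q ℤ.+ q′)
    (trans (lem a b c) (trans (cong₂ ℤ._+_ e e′) (sym (ℤP.*-distribʳ-+ (+ n) q q′))))
    where
    lem : ∀ a b c → a ℤ.- c ≡ (a ℤ.- b) ℤ.+ (b ℤ.- c)
    lem = solve-∀

  cong-diff : ∀ {a b c d} → a ℤ.- b ≡ c ℤ.- d → Congr n a b → Congr n c d
  cong-diff e c with cong-elim c
  ... | q , e′ = cong-intro q (trans (sym e) e′)

  cong-+ʳ : ∀ {a b} e → Congr n a b → Congr n (a ℤ.+ e) (b ℤ.+ e)
  cong-+ʳ {a} {b} e = cong-diff (lem a b e)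
    where
    lem : ∀ a b e → a ℤ.- b ≡ a ℤ.+ e ℤ.- (b ℤ.+ e)
    lem = solve-∀

  cong-shift : ∀ a → Congr n (a ℤ.+ + n) a
  cong-shift a = cong-intro (+ 1) (lem a (+ n))
    where
    lem : ∀ a m → a ℤ.+ m ℤ.- a ≡ + 1 ℤ.* m
    lem = solve-∀

  cong-ℕ-≤ : ∀ {x y} → x ≤ y → y ∸ x < n → Congr n (+ x) (+ y) → x ≡ y
  cong-ℕ-≤ {x} {y} x≤y small (congr c) with y ∸ x in eq | subst (n ∣_) (trans (cong ∣_∣ (ℤP.m-n≡m⊖n x y)) (ℤP.∣⊖∣-≤ x≤y)) c
  ... | zero | _ = ℕP.≤-antisym x≤y (ℕP.m∸n≡0⇒m≤n eq)
  ... | suc z | n∣ = contradiction (∣⇒≤ n∣) (ℕP.<⇒≱ small)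

  -- At least one of the truncated differences is zero; the other is the distance, below `n` and
  -- divisible by it.
  cong-ℕ : ∀ {x y} → x ∸ y < n → y ∸ x < n → Congr n (+ x) (+ y) → x ≡ y
  cong-ℕ {x} {y} l l′ c with ℕP.≤-total x y
  ... | inj₁ x≤y = cong-ℕ-≤ x≤y l′ c
  ... | inj₂ y≤x = sym (cong-ℕ-≤ y≤x l (cong-sym c))

  label-injective : ∀ {u v : Fin n} → Congr n (label u) (label v) → u ≡ v
  label-injective {u} {v} c = FinP.toℕ-injective (ℕP.suc-injective
    (cong-ℕ (small u v) (small v u) c))
    where
    small : ∀ (u v : Fin n) → toℕ u ∸ toℕ v < n
    small u v = ℕP.≤-<-trans (ℕP.m∸n≤m (toℕ u) (toℕ v)) (FinP.toℕ<n u)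

  class : .{{_ : ℕ.NonZero n}} → ∀ k → ∃ λ (v : Fin n) → Congr n k (label v)
  -- Labels run from 1 to `n`, hence the remainder of `k - 1`.
  class k = fromℕ< (ℤD.n%ℕd<d (k ℤ.- + 1) n) , cong-intro (j ℤD./ℕ n)
    (trans (cong (λ z → k ℤ.- (+ suc z)) (FinP.toℕ-fromℕ< (ℤD.n%ℕd<d j n)))
      (trans (cong (λ z → k ℤ.- z) (ℤP.pos-+ 1 r))
      (trans (lem₁ k (+ r)) (trans (cong (ℤ._- + r) (ℤD.a≡a%ℕn+[a/ℕn]*n j n)) (lem₂ (+ r) _)))))
    where
    j = k ℤ.- + 1
    r = j ℤD.%ℕ n
    lem₁ : ∀ k r → k ℤ.- (+ 1 ℤ.+ r) ≡ k ℤ.- + 1 ℤ.- r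
    lem₁ = solve-∀
    lem₂ : ∀ r z → r ℤ.+ z ℤ.- r ≡ z
    lem₂ = solve-∀

  At : ℤ → Fin n → Set
  At k v = Congr n k (label v)

  at-unique : ∀ {k u v} → At k u → At k v → u ≡ v
  at-unique {k} p q = label-injective (cong-trans (cong-sym p) q)

  -- r is the reflection ((i , i + d)) with i ≡ x and i + d ≡ y.
  record Step (r : Pair) (x y : Fin n) (d : ℕ) : Set where
    field
      up    : ∀ k → At k x → act n r k ≡ k ℤ.+ + d
      down  : ∀ k → At k y → act n r k ≡ k ℤ.- + d
      fixed : ∀ k → ¬ At k x → ¬ At k y → act n r k ≡ k
      shift : Congr n (label x ℤ.+ + d) (label y)
      d>0   : 0 < d
      x≢y   : x ≢ y

  open Step

  up-at : ∀ {r x y d} → Step r x y d → ∀ {k} → At k x → At (k ℤ.+ + d) y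
  up-at {d = d} s {k} at = cong-trans (cong-+ʳ (+ d) at) (shift s)

  down-at : ∀ {r x y d} → Step r x y d → ∀ {k} → At k y → At (k ℤ.- + d) x
  down-at {x = x} {d = d} s {k} at = cong-diff (lem k (label x) (+ d))
    (cong-trans at (cong-sym (shift s)))
    where
    lem : ∀ k x d → k ℤ.- (x ℤ.+ d) ≡ k ℤ.- d ℤ.- x
    lem = solve-∀

  step-intro : ∀ {a b x y} → a ℤ.< b → At a x → At b y → x ≢ y → Step (a , b) x y ∣ b ℤ.- a ∣
  step-intro {a} {b} {x} {y} a<b ax by x≢y = record
    { up = λ k kx → trans (if-true (n ∣? ∣ k ℤ.- a ∣) (raw (cong-trans kx (cong-sym ax))))
        (trans (lem₁ k a b) (cong (ℤ._+_ k) (sym d≡)))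
    ; down = λ k ky → trans (if-false (n ∣? ∣ k ℤ.- a ∣) (λ c → x≢y (at-unique (cong-trans (congr c) ax) ky)))
        (trans (if-true (n ∣? ∣ k ℤ.- b ∣) (raw (cong-trans ky (cong-sym by))))
          (trans (lem₂ k a b) (cong (ℤ._-_ k) (sym d≡))))
    ; fixed = λ k ¬kx ¬ky → trans (if-false (n ∣? ∣ k ℤ.- a ∣) (λ c → ¬kx (cong-trans (congr c) ax)))
        (if-false (n ∣? ∣ k ℤ.- b ∣) (λ c → ¬ky (cong-trans (congr c) by)))
    ; shift = cong-trans
        (cong-trans (cong-+ʳ (+ d) (cong-sym ax))
          (cong-reflexive (trans (cong (ℤ._+_ a) d≡) (lem₃ a b)))) by
    ; d>0 = ℤP.drop‿+<+ (subst (+ 0 ℤ.<_) (sym d≡) (subst (ℤ._< b ℤ.- a) (ℤP.+-inverseʳ a) (ℤP.+-monoˡ-< (ℤ.- a) a<b)))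
    ; x≢y = x≢y
    }
    where
    d = ∣ b ℤ.- a ∣
    d≡ : + d ≡ b ℤ.- a
    d≡ = ℤP.0≤i⇒+∣i∣≡i (ℤP.i≤j⇒0≤j-i (ℤP.<⇒≤ a<b))
    lem₁ : ∀ k a b → k ℤ.- a ℤ.+ b ≡ k ℤ.+ (b ℤ.- a)
    lem₁ = solve-∀
    lem₂ : ∀ k a b → k ℤ.- b ℤ.+ a ≡ k ℤ.- (b ℤ.- a)
    lem₂ = solve-∀
    lem₃ : ∀ a b → a ℤ.+ (b ℤ.- a) ≡ b
    lem₃ = solve-∀

  at? : ∀ k v → Dec (At k v)
  at? k v = map′ congr raw (n ∣? ∣ k ℤ.- label v ∣)

  step-≗ : ∀ {r s x y d} → Step r x y d → Step s x y d → r ≈ᵣ[ n ] s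
  step-≗ {x = x} {y} p q k with at? k x | at? k y
  ... | yes kx | _ = trans (up p k kx) (sym (up q k kx))
  ... | no _ | yes ky = trans (down p k ky) (sym (down q k ky))
  ... | no ¬kx | no ¬ky = trans (fixed p k ¬kx ¬ky) (sym (fixed q k ¬kx ¬ky))

  step-resp-≈ : ∀ {r s x y d} → r ≈ᵣ[ n ] s → Step s x y d → Step r x y d
  step-resp-≈ e p = record { up = λ k c → trans (e k) (up p k c) ; down = λ k c → trans (e k) (down p k c)
    ; fixed = λ k c c′ → trans (e k) (fixed p k c c′) ; shift = shift p ; d>0 = d>0 p ; x≢y = x≢y p }

  d-unique : ∀ {r s x y d d′} → Step r x y d → Step s x y d′ → d < n → d′ < n → d ≡ d′
  d-unique {x = x} {d = d} {d′} p q l l′ = cong-ℕ (ℕP.≤-<-trans (ℕP.m∸n≤m d d′) l) (ℕP.≤-<-trans (ℕP.m∸n≤m d′ d) l′)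
    (cong-diff (lem (label x) (+ d) (+ d′))
      (cong-trans (shift p) (cong-sym (shift q))))
    where
    lem : ∀ x d d′ → x ℤ.+ d ℤ.- (x ℤ.+ d′) ≡ d ℤ.- d′
    lem = solve-∀

  private
    -- Refutes the cases in which a class moved up by one description of a reflection is fixed or
    -- moved down by another.
    up≢ : ∀ {k d} → 0 < d → k ℤ.+ + d ℤ.≤ k → ∀ {A : Set} → A
    up≢ {k} {d} l e = contradiction (ℤP.≤-<-trans e (subst (ℤ._< k ℤ.+ + d) (ℤP.+-identityʳ k) (ℤP.+-monoʳ-< k (ℤ.+<+ l)))) (ℤP.<-irrefl refl)

  -- The class moved upwards is determined by the reflection.
  step-unique : ∀ {r x y d x′ y′ d′} → Step r x y d → Step r x′ y′ d′ → x ≡ x′ × y ≡ y′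
  step-unique {r} {x} {y} {d} {x′} {y′} {d′} p q with at? (label x) x′
  ... | yes c = x≡ , y≡
    where
    x≡ = label-injective c
    d≡ : + d ≡ + d′
    d≡ = +-cancelˡ (label x) (+ d) (+ d′) (trans (sym (up p (label x) (cong-refl))) (up q (label x) c))
    y≡ = at-unique (shift p)
      (subst (λ z → At (label x ℤ.+ z) y′) (sym d≡) (up-at q {label x} c))
  ... | no c with at? (label x) y′
  ... | yes c′ = up≢ {label x} (d>0 p) (ℤP.≤-trans (ℤP.≤-reflexive (trans (sym (up p (label x) (cong-refl))) (down q (label x) c′))) (ℤP.i-j≤i (label x) (+ d′)))
  ... | no c′ = up≢ {label x} (d>0 p) (ℤP.≤-reflexive (trans (sym (up p (label x) (cong-refl))) (fixed q (label x) c c′)))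

  -- n divides d + d′, which lies strictly between 0 and 2n.
  opposite-sum : ∀ {r s x y d d′} → Step r x y d → Step s y x d′ → d < n → d′ < n → d ℕ.+ d′ ≡ n
  opposite-sum {x = x} {y} {d} {d′} p q l l′ with d ℕ.+ d′ | dvd | ℕP.≤-trans (d>0 p) (ℕP.m≤m+n d d′) | ℕP.+-mono-< l l′
    where
    dvd : n ∣ d ℕ.+ d′
    dvd = subst (n ∣_) (cong ∣_∣ (trans (lem (label x) (+ d) (+ d′)) (sym (ℤP.pos-+ d d′)))) (raw (
      cong-trans (cong-+ʳ (+ d′) (shift p)) (shift q)))
      where
      lem : ∀ x d d′ → x ℤ.+ d ℤ.+ d′ ℤ.- x ≡ d ℤ.+ d′
      lem = solve-∀
  ... | e | divides 1 eq | _ | _ = trans eq (ℕP.+-identityʳ n)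
  ... | e | divides 0 eq | 0<e | _ = contradiction (subst (0 <_) eq 0<e) λ ()
  ... | e | divides (suc (suc q)) eq | _ | e<2n = contradiction e<2n
    (ℕP.≤⇒≯ (subst (n ℕ.+ n ≤_) (trans (ℕP.+-assoc n n (q ℕ.* n)) (sym eq)) (ℕP.m≤m+n (n ℕ.+ n) (q ℕ.* n))))

  dist : Fin n → Fin n → ℕ
  dist x y = let r = stepRefl n x y in ∣ proj₂ r ℤ.- proj₁ r ∣

  stepRefl-ascent : ∀ {x y} → label x ℤ.< label y → stepRefl n x y ≡ (label x , label y)
  stepRefl-ascent {x} {y} = if-true (label x ℤP.<? label y)

  stepRefl-descent : ∀ {x y} → ¬ label x ℤ.< label y → stepRefl n x y ≡ (label x ℤ.- + n , label y)
  stepRefl-descent {x} {y} = if-false (label x ℤP.<? label y)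

  stepRefl-target : ∀ x y → proj₂ (stepRefl n x y) ≡ label y
  stepRefl-target x y with does (label x ℤP.<? label y)
  ... | true = refl
  ... | false = refl

  stepRefl-source : ∀ x y → At (proj₁ (stepRefl n x y)) x
  stepRefl-source x y with does (label x ℤP.<? label y)
  ... | true = cong-refl
  ... | false = cong-sym (cong-diff (lem (label x) (+ n)) (cong-shift (label x)))
    where
    lem : ∀ x m → x ℤ.+ m ℤ.- x ≡ x ℤ.- (x ℤ.- m)
    lem = solve-∀

  private
    -n<0 : ∀ (x : Fin n) → label x ℤ.- + n ℤ.≤ + 0
    -n<0 x = ℤP.i≤j⇒i-j≤0 (ℤ.+≤+ (FinP.toℕ<n x))

  stepRefl-< : ∀ x y → proj₁ (stepRefl n x y) ℤ.< proj₂ (stepRefl n x y)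
  stepRefl-< x y with label x ℤP.<? label y
  ... | yes l rewrite stepRefl-ascent {x} {y} l = l
  ... | no ¬l rewrite stepRefl-descent {x} {y} ¬l = ℤP.≤-<-trans (-n<0 x) (ℤ.+<+ (s≤s z≤n))

  -- A descent from `x` to `y` has shift `n - (x - y)`, and `x - y` is positive since the vertices
  -- differ.
  dist<n : ∀ x y → x ≢ y → dist x y < n
  dist<n x y x≢y with label x ℤP.<? label y
  ... | yes (ℤ.+<+ l) rewrite stepRefl-ascent {x} {y} (ℤ.+<+ l) = subst (_< n)
    (sym (trans (cong ∣_∣ (ℤP.m-n≡m⊖n (suc (toℕ y)) (suc (toℕ x)))) (cong ∣_∣ (ℤP.⊖-≥ (ℕP.<⇒≤ l)))))
    (ℕP.≤-<-trans (ℕP.m∸n≤m (toℕ y) (toℕ x)) (FinP.toℕ<n y))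
  ... | no ¬l rewrite stepRefl-descent {x} {y} ¬l = subst (_< n) (sym eq) (ℕP.∸-monoʳ-< {n} {toℕ x ∸ toℕ y} {0} (ℕP.m<n⇒0<n∸m y<x) (ℕP.≤-trans (ℕP.m∸n≤m (toℕ x) (toℕ y)) (ℕP.<⇒≤ (FinP.toℕ<n x))))
    where
    y<x : toℕ y < toℕ x
    y<x with ℕP.<-cmp (toℕ x) (toℕ y)
    ... | tri< l _ _ = contradiction (ℤ.+<+ (s≤s l)) ¬l
    ... | tri≈ _ e _ = contradiction (FinP.toℕ-injective e) x≢y
    ... | tri> _ _ l = l
    lem : ∀ x y m → y ℤ.- (x ℤ.- m) ≡ m ℤ.- (x ℤ.- y)
    lem = solve-∀
    eq : ∣ label y ℤ.- (label x ℤ.- + n) ∣ ≡ n ∸ (toℕ x ∸ toℕ y)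
    eq = cong ∣_∣ (trans (lem (label x) (label y) (+ n)) (trans
      (cong (ℤ._-_ (+ n)) (trans (ℤP.m-n≡m⊖n (suc (toℕ x)) (suc (toℕ y))) (ℤP.⊖-≥ (s≤s (ℕP.<⇒≤ y<x)))))
      (trans (ℤP.m-n≡m⊖n n (toℕ x ∸ toℕ y)) (ℤP.⊖-≥ (ℕP.≤-trans (ℕP.m∸n≤m (toℕ x) (toℕ y)) (ℕP.<⇒≤ (FinP.toℕ<n x)))))))

  stepRefl-step : ∀ x y → x ≢ y → Step (stepRefl n x y) x y (dist x y)
  stepRefl-step x y x≢y = step-intro (stepRefl-< x y) (stepRefl-source x y)
    (cong-reflexive (stepRefl-target x y)) x≢y

-- Finite sums

∑ : ∀ {n} → (Fin n → ℕ) → ℕ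
∑ f = sum (tabulateᴸ f)

∑-cong : ∀ {n} {f g : Fin n → ℕ} → (∀ v → f v ≡ g v) → ∑ f ≡ ∑ g
∑-cong {zero} e = refl
∑-cong {suc n} e = cong₂ _+_ (e zero) (∑-cong (e ∘ suc))

∑-const : ∀ n x → ∑ {n} (λ _ → x) ≡ n * x
∑-const zero x = refl
∑-const (suc n) x = cong (_+_ x) (∑-const n x)

∑-update : ∀ {n} {f g : Fin n → ℕ} m x → f m ≡ x + g m → (∀ v → v ≢ m → f v ≡ g v) → ∑ f ≡ x + ∑ g
∑-update {f = f} {g} zero x e h =
  trans (cong₂ _+_ e (∑-cong λ v → h (suc v) λ ())) (ℕP.+-assoc x (g zero) _)
∑-update {f = f} {g} (suc m) x e h =
  trans (cong₂ _+_ (h zero λ ()) (∑-update m x e λ v v≢ → h (suc v) (v≢ ∘ FinP.suc-injective)))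
    (trans (sym (ℕP.+-assoc (g zero) x _)) (trans (cong (λ z → z + ∑ (g ∘ suc)) (ℕP.+-comm (g zero) x)) (ℕP.+-assoc x (g zero) _)))

∑-mono : ∀ {n} {f g : Fin n → ℕ} → (∀ v → f v ≤ g v) → ∑ f ≤ ∑ g
∑-mono {zero} h = z≤n
∑-mono {suc n} h = ℕP.+-mono-≤ (h zero) (∑-mono (h ∘ suc))

-- A strict inequality at one index could not be made up for at another.
∑-tight : ∀ {n} {f g : Fin n → ℕ} → (∀ v → f v ≤ g v) → ∑ g ≤ ∑ f → ∀ v → f v ≡ g v
∑-tight {suc n} {f} {g} h le zero = ℕP.≤-antisym (h zero)
  (ℕP.+-cancelʳ-≤ (∑ (g ∘ suc)) (g zero) (f zero) (ℕP.≤-trans le (ℕP.+-monoʳ-≤ (f zero) (∑-mono (h ∘ suc)))))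
∑-tight {suc n} {f} {g} h le (suc v) = ∑-tight (h ∘ suc)
  (ℕP.+-cancelˡ-≤ (g zero) _ _ (ℕP.≤-trans le (ℕP.+-monoˡ-≤ _ (h zero)))) v

∑-except : ∀ {n} (f : Fin n → ℕ) r x → f r ≡ 0 → (∀ v → v ≢ r → f v ≡ x) → x + ∑ f ≡ n * x
∑-except {n} f r x e h = trans (sym (∑-update r x (trans (sym (ℕP.+-identityʳ x)) (cong (_+_ x) (sym e)))
  λ v v≢ → sym (h v v≢))) (∑-const n x)

-- Token dynamics

-- Applying the factors from right to left, a token starts at c L and follows c backwards, and
-- each factor exchanges it with the particle it meets: step t carries the token from c (suc t)
-- to c t and the particle at c t to c (suc t).  The arguments j s stand for the j steps
-- s + j - 1 , … , s; pos is the final position of the particle starting at v and times lists,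
-- in increasing order, the steps that move it.  Both are meaningless for the token itself.
module Token {n : ℕ} (c : ℕ → Fin n) where

  pos : ℕ → ℕ → Fin n → Fin n
  pos zero s v = v
  pos (suc j) s v with pos j (suc s) v ≟ᶠ c s
  ... | yes _ = c (suc s)
  ... | no _ = pos j (suc s) v

  times : ℕ → ℕ → Fin n → List ℕ
  times zero s v = []
  times (suc j) s v with pos j (suc s) v ≟ᶠ c s
  ... | yes _ = s ∷ times j (suc s) v
  ... | no _ = times j (suc s) v

  Avoids : ℕ → ℕ → Fin n → Set
  Avoids s t x = ∀ u → s ≤ u → u < t → c u ≢ x

  avoids-cons : ∀ {s t x} → c s ≢ x → Avoids (suc s) t x → Avoids s t x
  avoids-cons ne av u s≤u u<t with ℕP.m≤n⇒m<n∨m≡n s≤u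
  ... | inj₁ s<u = av u s<u u<t
  ... | inj₂ refl = ne

  -- Steps run downwards, so the head of the list is the move made last: `j′` steps come before it,
  -- and afterwards the particle rests at `c (suc k)`, where the token does not come at any index
  -- from `s` to `k - 1`.
  times-∷ : ∀ j s {v k ks} → times j s v ≡ k ∷ ks → ∃ λ j′ →
    j′ + suc k ≡ j + s × times j′ (suc k) v ≡ ks × pos j′ (suc k) v ≡ c k × pos j s v ≡ c (suc k)
    × s ≤ k × Avoids s k (c (suc k))
  times-∷ (suc j) s {v} e with pos j (suc s) v ≟ᶠ c s
  times-∷ (suc j) s refl | yes p =
    j , ℕP.+-suc j s , refl , p , refl , ℕP.≤-refl , λ u s≤u u<s → contradiction s≤u (ℕP.<⇒≱ u<s)
  times-∷ (suc j) s e | no ¬p =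
    let j′ , e₁ , e₂ , e₃ , e₄ , l , av = times-∷ j (suc s) e
    in j′ , trans e₁ (ℕP.+-suc j s) , e₂ , e₃ , e₄ , ℕP.<⇒≤ l
      , avoids-cons (λ q → ¬p (trans e₄ (sym q))) av

  times-[] : ∀ j s {v} → times j s v ≡ [] → pos j s v ≡ v × Avoids s (j + s) v
  times-[] zero s e = refl , λ u s≤u u<s → contradiction s≤u (ℕP.<⇒≱ u<s)
  times-[] (suc j) s {v} e with pos j (suc s) v ≟ᶠ c s
  times-[] (suc j) s {v} () | yes p
  ... | no ¬p = let e₁ , av = times-[] j (suc s) e in
    e₁ , avoids-cons (λ q → ¬p (trans e₁ (sym q))) (subst (λ z → Avoids (suc s) z v) (ℕP.+-suc j s) av)

  times-move : ∀ j s {v} → pos j (suc s) v ≡ c s →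
    pos (suc j) s v ≡ c (suc s) × times (suc j) s v ≡ s ∷ times j (suc s) v
  times-move j s {v} e with pos j (suc s) v ≟ᶠ c s
  ... | yes _ = refl , refl
  ... | no ¬p = contradiction e ¬p

  times-stay : ∀ i j s {s′ v x} → i + s ≡ s′ → pos j s′ v ≡ x → Avoids s s′ x →
    pos (i + j) s v ≡ x × times (i + j) s v ≡ times j s′ v
  times-stay zero j s refl e av = e , refl
  times-stay (suc i) j s {v = v} refl e av
    with pos (i + j) (suc s) v ≟ᶠ c s | times-stay i j (suc s) {v = v} (ℕP.+-suc i s) e (λ u s≤u → av u (ℕP.<⇒≤ s≤u))
  ... | yes p | e₁ , _ = contradiction (trans (sym p) e₁) (av s ℕP.≤-refl (s≤s (ℕP.m≤n+m s i)))
  ... | no _ | r = r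

  -- Weight 1 counts the moves of `v`; the shifts as weights give its displacement.
  acc : (ℕ → ℕ) → ℕ → ℕ → Fin n → ℕ
  acc w j s v = sum (map w (times j s v))

  total : (ℕ → ℕ) → ℕ → ℕ → ℕ
  total w zero s = 0
  total w (suc j) s = w s + total w j (suc s)

  total-1 : ∀ j s → total (λ _ → 1) j s ≡ j
  total-1 zero s = refl
  total-1 (suc j) s = cong suc (total-1 j (suc s))

  sum-map-1 : ∀ (xs : List ℕ) → sum (map (λ _ → 1) xs) ≡ length xs
  sum-map-1 [] = refl
  sum-map-1 (x ∷ xs) = cong suc (sum-map-1 xs)

  module _ (L : ℕ) (loopless : ∀ t → t < L → c t ≢ c (suc t)) where

    -- The token gets 0, so that a sum over all vertices is a sum over the particles.
    accᵖ : (ℕ → ℕ) → ℕ → ℕ → Fin n → ℕ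
    accᵖ w j s v = if does (v ≟ᶠ c L) then 0 else acc w j s v

    shift-bound : ∀ {j s} → suc j + s ≡ L → j + suc s ≡ L
    shift-bound {j} {s} e = trans (ℕP.+-suc j s) e

    step-bound : ∀ {j s} → suc j + s ≡ L → s < L
    step-bound {j} {s} e = subst (s <_) e (s≤s (ℕP.m≤n+m s j))

    pos-≢-token : ∀ j s → j + s ≡ L → ∀ {v} → v ≢ c L → pos j s v ≢ c s
    pos-≢-token zero s refl v≢ = v≢
    pos-≢-token (suc j) s e {v} v≢ with pos j (suc s) v ≟ᶠ c s
    ... | yes p = λ q → loopless s (step-bound e) (sym q)
    ... | no ¬p = ¬p

    -- The vertex the token leaves is filled by the particle it displaces; all other particles stay.
    pos-surjective : ∀ j s → j + s ≡ L → ∀ y → y ≢ c s → ∃ λ v → v ≢ c L × pos j s v ≡ y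
    pos-surjective zero s refl y y≢ = y , y≢ , refl
    pos-surjective (suc j) s e y y≢ with y ≟ᶠ c (suc s)
    ... | yes refl =
      let v , v≢ , p = pos-surjective j (suc s) (shift-bound e) (c s) (loopless s (step-bound e))
      in v , v≢ , proj₁ (times-move j s p)
    ... | no y≢′ =
      let v , v≢ , p = pos-surjective j (suc s) (shift-bound e) y y≢′
      in v , v≢ , proj₁ (times-stay 1 j s refl p λ u s≤u u<s q → y≢
        (trans (sym q) (cong c (ℕP.≤-antisym (ℕP.≤-pred u<s) s≤u))))

    pos-injective : ∀ j s → j + s ≡ L → ∀ {u v} → u ≢ c L → v ≢ c L → pos j s u ≡ pos j s v → u ≡ v
    pos-injective zero s e u≢ v≢ q = q
    pos-injective (suc j) s e {u} {v} u≢ v≢ q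
      with pos j (suc s) u ≟ᶠ c s | pos j (suc s) v ≟ᶠ c s
    ... | yes p | yes p′ = pos-injective j (suc s) (shift-bound e) u≢ v≢ (trans p (sym p′))
    ... | yes p | no ¬p′ = contradiction (sym q) (pos-≢-token j (suc s) (shift-bound e) v≢)
    ... | no ¬p | yes p′ = contradiction q (pos-≢-token j (suc s) (shift-bound e) u≢)
    ... | no ¬p | no ¬p′ = pos-injective j (suc s) (shift-bound e) u≢ v≢ q

    mover : ∀ j s → suc j + s ≡ L → ∃ λ v → v ≢ c L × pos j (suc s) v ≡ c s
    mover j s e = pos-surjective j (suc s) (shift-bound e) (c s) (loopless s (step-bound e))

    -- Double counting: each step moves exactly one particle, so its weight enters exactly one list.
    ∑-accᵖ : ∀ w j s → j + s ≡ L → ∑ (accᵖ w j s) ≡ total w j s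
    ∑-accᵖ w zero s e = trans (∑-cong zeros) (trans (∑-const n 0) (ℕP.*-zeroʳ n))
      where
      zeros : ∀ v → accᵖ w zero s v ≡ 0
      zeros v with does (v ≟ᶠ c L)
      ... | true = refl
      ... | false = refl
    ∑-accᵖ w (suc j) s e = trans (∑-update m (w s) atm off) (cong (_+_ (w s)) (∑-accᵖ w j (suc s) (shift-bound e)))
      where
      m = proj₁ (mover j s e)
      m≢ = proj₁ (proj₂ (mover j s e))
      pm = proj₂ (proj₂ (mover j s e))
      atm : accᵖ w (suc j) s m ≡ w s + accᵖ w j (suc s) m
      atm = trans (if-false (m ≟ᶠ c L) m≢) (trans (cong (sum ∘ map w) (proj₂ (times-move j s pm)))
        (cong (_+_ (w s)) (sym (if-false (m ≟ᶠ c L) m≢))))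
      off : ∀ v → v ≢ m → accᵖ w (suc j) s v ≡ accᵖ w j (suc s) v
      off v v≢m with v ≟ᶠ c L
      ... | yes _ = refl
      ... | no v≢ with pos j (suc s) v ≟ᶠ c s
      ... | yes p = contradiction (pos-injective j (suc s) (shift-bound e) v≢ m≢ (trans p (sym pm))) v≢m
      ... | no _ = refl

    times-cover : ∀ j s → j + s ≡ L → ∀ t → s ≤ t → t < L → ∃ λ v → v ≢ c L × t ∈ times j s v
    times-cover zero s refl t s≤t t<s = contradiction s≤t (ℕP.<⇒≱ t<s)
    times-cover (suc j) s e t s≤t t<L with ℕP.m≤n⇒m<n∨m≡n s≤t
    ... | inj₂ refl =
      let v , v≢ , p = mover j s e
      in v , v≢ , subst (s ∈_) (sym (proj₂ (times-move j s p))) (here refl)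
    ... | inj₁ s<t = let v , v≢ , t∈ = times-cover j (suc s) (shift-bound e) t s<t t<L in v , v≢ , grow v t∈
      where
      grow : ∀ v → t ∈ times j (suc s) v → t ∈ times (suc j) s v
      grow v t∈ with pos j (suc s) v ≟ᶠ c s
      ... | yes _ = there t∈
      ... | no _ = t∈

    -- Action of the factors on the integers

    module _ (R : ℕ → Pair) (d : ℕ → ℕ)
      (steps : ∀ t → t < L → Step (R t) (c t) (c (suc t)) (d t)) where

      open Step

      comp : ℕ → ℕ → ℤ → ℤ
      comp zero s k = k
      comp (suc j) s k = act n (R s) (comp j (suc s) k)

      comp-particle : ∀ j s → j + s ≡ L → ∀ {k v} → v ≢ c L → At k v →
        comp j s k ≡ k ℤ.+ + acc d j s v × At (comp j s k) (pos j s v)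
      comp-particle zero s e {k} v≢ kv = sym (ℤP.+-identityʳ k) , kv
      comp-particle (suc j) s e {k} {v} v≢ kv
        with pos j (suc s) v ≟ᶠ c s | comp-particle j (suc s) (shift-bound e) v≢ kv
      ... | yes p | e₁ , at = e₂ , subst (λ z → At z (c (suc s))) (sym (up st _ at′)) (up-at st at′)
        where
        st = steps s (step-bound e)
        at′ : At (comp j (suc s) k) (c s)
        at′ = subst (At _) p at
        lem : ∀ k x y → k ℤ.+ x ℤ.+ y ≡ k ℤ.+ (y ℤ.+ x)
        lem = solve-∀
        e₂ : act n (R s) (comp j (suc s) k) ≡ k ℤ.+ + (d s + acc d j (suc s) v)
        e₂ = trans (up st _ at′) (trans (cong (ℤ._+ (+ d s)) e₁)
          (trans (lem k (+ acc d j (suc s) v) (+ d s)) (cong (ℤ._+_ k) (sym (ℤP.pos-+ (d s) (acc d j (suc s) v))))))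
      ... | no ¬p | e₁ , at = trans e₂ e₁ , subst (λ z → At z (pos j (suc s) v)) (sym e₂) at
        where
        e₂ = fixed (steps s (step-bound e)) (comp j (suc s) k)
          (λ at′ → ¬p (at-unique at at′))
          (λ at′ → pos-≢-token j (suc s) (shift-bound e) v≢ (at-unique at at′))

      comp-token : ∀ j s → j + s ≡ L → ∀ {k} → At k (c L) →
        comp j s k ≡ k ℤ.- + total d j s × At (comp j s k) (c s)
      comp-token zero s refl {k} kv = sym (ℤP.+-identityʳ k) , kv
      comp-token (suc j) s e {k} kv with comp-token j (suc s) (shift-bound e) kv
      ... | e₁ , at = e₂ , subst (λ z → At z (c s)) (sym (down st _ at)) (down-at st at)
        where
        st = steps s (step-bound e)
        lem : ∀ k x y → k ℤ.- x ℤ.- y ≡ k ℤ.- (y ℤ.+ x)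
        lem = solve-∀
        e₂ : act n (R s) (comp j (suc s) k) ≡ k ℤ.- + (d s + total d j (suc s))
        e₂ = trans (down st _ at) (trans (cong (ℤ._- (+ d s)) e₁)
          (trans (lem k (+ total d j (suc s)) (+ d s)) (cong (ℤ._-_ k) (sym (ℤP.pos-+ (d s) (total d j (suc s)))))))

      prod-comp : ∀ {m} (rs : Vec Pair m) s → (∀ i → lookup rs i ≈ᵣ[ n ] R (toℕ i + s)) →
        ∀ k → prod n rs k ≡ comp m s k
      prod-comp [] s h k = refl
      prod-comp (r ∷ rs) s h k = trans (h zero _) (cong (act n (R s))
        (prod-comp rs (suc s) (λ i z → trans (h (suc i) z) (cong (λ q → act n (R q) z) (sym (ℕP.+-suc (toℕ i) s)))) k))

-- Tours

module Touring {n : ℕ} (c : ℕ → Fin n) (L : ℕ) where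

  open Token c

  -- Indices are those of the walk, so the product performs move `last` before move `first`. By
  -- `after` the particle waits at `v` until `last`; by `during` it then stays at `c first` until
  -- `first`; by `before` it stays home from then on.
  record Excursion (v : Fin n) : Set where
    field
      first last : ℕ
      first<last : first < last
      last<L     : last < L
      enter      : c (suc first) ≡ v
      leave      : c last ≡ v
      return     : c (suc last) ≡ c first
      before     : Avoids 0 first v
      during     : Avoids (suc first) last (c first)
      after      : Avoids (suc last) L v

  open Excursion

  excursion-times : ∀ {v} (e : Excursion v) → times L 0 v ≡ first e ∷ last e ∷ [] × pos L 0 v ≡ v
  excursion-times {v} e = subst (λ z → times z 0 v ≡ first e ∷ last e ∷ [] × pos z 0 v ≡ v) end≡L
    ( trans (proj₂ s₅) (trans (proj₂ s₄) (cong (first e ∷_) (trans (proj₂ s₃) (trans (proj₂ s₂) (cong (last e ∷_) (proj₂ s₁))))))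
    , proj₁ s₅ )
    where
    i = last e ∸ suc (first e)
    j = L ∸ suc (last e)
    s₁ = times-stay j 0 (suc (last e)) (ℕP.m∸n+n≡m (last<L e)) refl (after e)
    s₂ = times-move (j + 0) (last e) (trans (proj₁ s₁) (sym (leave e)))
    s₃ = times-stay i (suc (j + 0)) (suc (first e)) (ℕP.m∸n+n≡m (first<last e))
      (trans (proj₁ s₂) (return e)) (during e)
    s₄ = times-move (i + suc (j + 0)) (first e) (proj₁ s₃)
    s₅ = times-stay (first e) (suc (i + suc (j + 0))) 0 (ℕP.+-identityʳ _) (trans (proj₁ s₄) (enter e)) (before e)
    lem : ∀ a i j → a + suc (i + suc (j + 0)) ≡ j + suc (i + suc a)
    lem = ℕSolver.solve-∀
    end≡L : first e + suc (i + suc (j + 0)) ≡ L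
    end≡L = trans (lem (first e) i j) (trans (cong (λ z → j + suc z) (ℕP.m∸n+n≡m (first<last e))) (ℕP.m∸n+n≡m (last<L e)))

  times-excursion : ∀ {v k′ k} → times L 0 v ≡ k′ ∷ k ∷ [] → pos L 0 v ≡ v →
    Σ (Excursion v) λ e → first e ≡ k′ × last e ≡ k
  times-excursion {v} {k′} {k} e closed =
    let j₁ , i₁ , t₁ , p₁ , q₁ , _ , av₁ = times-∷ L 0 e
        j₂ , i₂ , t₂ , p₂ , q₂ , l , av₂ = times-∷ j₁ (suc k′) t₁
        p₃ , av₃ = times-[] j₂ (suc k) t₂
        end≡L = trans i₂ (trans i₁ (ℕP.+-identityʳ L))
        ret = trans (sym q₂) p₁
    in record
      { first = k′ ; last = k ; first<last = l
      ; last<L = subst (suc k ≤_) end≡L (ℕP.m≤n+m (suc k) j₂)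
      ; enter = trans (sym q₁) closed
      ; leave = trans (sym p₂) p₃
      ; return = ret
      ; before = subst (Avoids 0 k′) (trans (sym q₁) closed) av₁
      ; during = subst (Avoids (suc k′) k) ret av₂
      ; after = subst (λ z → Avoids (suc k) z v) end≡L av₃
      } , refl , refl

  avoids-snoc : ∀ {s t x} → Avoids s t x → c t ≢ x → Avoids s (suc t) x
  avoids-snoc av ne u s≤u u<st with ℕP.m≤n⇒m<n∨m≡n (ℕP.≤-pred u<st)
  ... | inj₁ u<t = av u s≤u u<t
  ... | inj₂ refl = ne

  -- With `j = L` and `s = 0` this is the rotation at `v` of the tree to be built.
  exits : ℕ → ℕ → Fin n → List (Fin n)
  exits zero s v = []
  exits (suc j) s v with c s ≟ᶠ v
  ... | yes _ = c (suc s) ∷ exits j (suc s) v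
  ... | no _ = exits j (suc s) v

  exits-head : ∀ j s {t v} → c t ≡ v → Avoids s t v → s ≤ t → t < j + s → ∃ λ l → exits j s v ≡ c (suc t) ∷ l
  exits-head zero s ct av s≤t t<s = contradiction s≤t (ℕP.<⇒≱ t<s)
  exits-head (suc j) s {t} {v} ct av s≤t t< with ℕP.m≤n⇒m<n∨m≡n s≤t | c s ≟ᶠ v
  ... | inj₂ refl | yes _ = _ , refl
  ... | inj₂ refl | no ¬p = contradiction ct ¬p
  ... | inj₁ s<t | yes p = contradiction p (av s ℕP.≤-refl s<t)
  ... | inj₁ s<t | no _ =
    exits-head j (suc s) ct (λ u l → av u (ℕP.<⇒≤ l)) s<t (subst (t <_) (sym (ℕP.+-suc j s)) t<)

  exits-avoid : ∀ j s {v} → Avoids s (j + s) v → exits j s v ≡ []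
  exits-avoid zero s av = refl
  exits-avoid (suc j) s {v} av with c s ≟ᶠ v
  ... | yes p = contradiction p (av s ℕP.≤-refl (s≤s (ℕP.m≤n+m s j)))
  ... | no _ = exits-avoid j (suc s) λ u l u< → av u (ℕP.<⇒≤ l) (subst (u <_) (ℕP.+-suc j s) u<)

  exits-last : ∀ j s {t v} → c t ≡ v → Avoids (suc t) (j + s) v → s ≤ t → t < j + s →
    ∃ λ l → exits j s v ≡ l ++ [ c (suc t) ]
  exits-last zero s ct av s≤t t<s = contradiction s≤t (ℕP.<⇒≱ t<s)
  exits-last (suc j) s {t} {v} ct av s≤t t< with ℕP.m≤n⇒m<n∨m≡n s≤t | c s ≟ᶠ v
  ... | inj₂ refl | yes _ =
    [] , cong (c (suc s) ∷_) (exits-avoid j (suc s) λ u l u< → av u l (subst (u <_) (ℕP.+-suc j s) u<))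
  ... | inj₂ refl | no ¬p = contradiction ct ¬p
  ... | inj₁ s<t | d with exits-last j (suc s) ct (λ u l u< → av u l (subst (u <_) (ℕP.+-suc j s) u<)) s<t
                            (subst (t <_) (sym (ℕP.+-suc j s)) t<)
  exits-last (suc j) s ct av s≤t t< | inj₁ s<t | yes _ | l , e = c (suc s) ∷ l , cong (c (suc s) ∷_) e
  exits-last (suc j) s ct av s≤t t< | inj₁ s<t | no _ | l , e = l , e

  exits-consec : ∀ j s {t t′ v} → c t ≡ v → c t′ ≡ v → Avoids (suc t) t′ v → s ≤ t → t < t′ → t′ < j + s →
    Consec (c (suc t)) (c (suc t′)) (exits j s v)
  exits-consec zero s ct ct′ av s≤t t<t′ t′< = contradiction (ℕP.≤-trans s≤t (ℕP.<⇒≤ t<t′)) (ℕP.<⇒≱ t′<)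
  exits-consec (suc j) s {t} {t′} {v} ct ct′ av s≤t t<t′ t′< with ℕP.m≤n⇒m<n∨m≡n s≤t | c s ≟ᶠ v
  ... | inj₂ refl | no ¬p = contradiction ct ¬p
  ... | inj₂ refl | yes _ with exits-head j (suc s) ct′ av t<t′ (subst (t′ <_) (sym (ℕP.+-suc j s)) t′<)
  ... | l , e = subst (λ z → Consec (c (suc s)) (c (suc t′)) (c (suc s) ∷ z)) (sym e) here
  exits-consec (suc j) s {t} {t′} {v} ct ct′ av s≤t t<t′ t′< | inj₁ s<t | d
    with exits-consec j (suc s) ct ct′ av s<t t<t′ (subst (t′ <_) (sym (ℕP.+-suc j s)) t′<)
  exits-consec (suc j) s ct ct′ av s≤t t<t′ t′< | inj₁ s<t | yes _ | r = there r
  exits-consec (suc j) s ct ct′ av s≤t t<t′ t′< | inj₁ s<t | no _ | r = r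

  exits-∈⁻ : ∀ j s {v w} → w ∈ exits j s v → ∃ λ t → s ≤ t × t < j + s × c t ≡ v × c (suc t) ≡ w
  exits-∈⁻ (suc j) s {v} m with c s ≟ᶠ v
  exits-∈⁻ (suc j) s (here refl) | yes p = s , ℕP.≤-refl , s≤s (ℕP.m≤n+m s j) , p , refl
  exits-∈⁻ (suc j) s (there m) | yes p =
    let t , l , t< , r = exits-∈⁻ j (suc s) m in t , ℕP.<⇒≤ l , subst (t <_) (ℕP.+-suc j s) t< , r
  exits-∈⁻ (suc j) s m | no _ =
    let t , l , t< , r = exits-∈⁻ j (suc s) m in t , ℕP.<⇒≤ l , subst (t <_) (ℕP.+-suc j s) t< , r

  exits-∈⁺ : ∀ j s {t v} → c t ≡ v → s ≤ t → t < j + s → c (suc t) ∈ exits j s v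
  exits-∈⁺ zero s ct s≤t t<s = contradiction s≤t (ℕP.<⇒≱ t<s)
  exits-∈⁺ (suc j) s {t} {v} ct s≤t t< with ℕP.m≤n⇒m<n∨m≡n s≤t | c s ≟ᶠ v
  ... | inj₂ refl | yes _ = here refl
  ... | inj₂ refl | no ¬p = contradiction ct ¬p
  ... | inj₁ s<t | yes _ = there (exits-∈⁺ j (suc s) ct s<t (subst (t <_) (sym (ℕP.+-suc j s)) t<))
  ... | inj₁ s<t | no _ = exits-∈⁺ j (suc s) ct s<t (subst (t <_) (sym (ℕP.+-suc j s)) t<)

  ∑-exits : ∀ j s → ∑ (λ v → length (exits j s v)) ≡ j
  ∑-exits zero s = trans (∑-const n 0) (ℕP.*-zeroʳ n)
  ∑-exits (suc j) s = trans (∑-update (c s) 1 atc off) (cong suc (∑-exits j (suc s)))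
    where
    atc : length (exits (suc j) s (c s)) ≡ suc (length (exits j (suc s) (c s)))
    atc with c s ≟ᶠ c s
    ... | yes _ = refl
    ... | no ¬p = contradiction refl ¬p
    off : ∀ v → v ≢ c s → length (exits (suc j) s v) ≡ length (exits j (suc s) v)
    off v v≢ with c s ≟ᶠ v
    ... | yes p = contradiction (sym p) v≢
    ... | no _ = refl

  -- The inequality is irrelevant in `exc`, so that the excursion of a vertex, and with it the times
  -- in `cover`, does not depend on the proof supplied.
  record Tour : Set where
    field
      loopless : ∀ t → t < L → c t ≢ c (suc t)
      closed   : c 0 ≡ c L
      exc      : ∀ v → .(v ≢ c L) → Excursion v
      cover    : ∀ t → t < L → ∃ λ v → Σ (v ≢ c L) λ v≢ → t ≡ first (exc v v≢) ⊎ t ≡ last (exc v v≢)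

  module FromTour (tour : Tour) where
    open Tour tour

    first<L : ∀ {v} (e : Excursion v) → first e < L
    first<L e = ℕP.<-trans (first<last e) (last<L e)

    first-least : ∀ {v t} (e : Excursion v) → c t ≡ v → first e ≤ t
    first-least {t = t} e ct with first e ℕ.≤? t
    ... | yes l = l
    ... | no ¬l = contradiction ct (before e t z≤n (ℕP.≰⇒> ¬l))

    -- Were the edge from a to its parent also the edge from b to its parent, with a and b
    -- swapped, each of a and b would be entered before the other.
    no-2-cycle : ∀ {a b} (e : Excursion a) (e′ : Excursion b) → c (first e) ≡ b → c (first e′) ≡ a → ¬ a ≢ b
    no-2-cycle {a} {b} e e′ p q ne =
      contradiction (trans (sym (enter e)) (trans (cong (c ∘ suc) (ℕP.≤-antisym (first-least e q) (first-least e′ p))) (enter e′))) ne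

    -- Two first entries into the same vertex coincide, as do two final exits from it; a first entry
    -- equal to a final exit would make two vertices each other's parents.
    dart-injective : ∀ {t t′} → t < L → t′ < L → c t ≡ c t′ → c (suc t) ≡ c (suc t′) → t ≡ t′
    dart-injective {t} {t′} t<L t′<L p q with cover t t<L | cover t′ t′<L
    ... | a , a≢ , inj₁ refl | b , b≢ , inj₁ refl with trans (sym (enter (exc a a≢))) (trans q (enter (exc b b≢)))
    ... | refl = refl
    dart-injective t<L t′<L p q | a , a≢ , inj₂ refl | b , b≢ , inj₂ refl
      with trans (sym (leave (exc a a≢))) (trans p (leave (exc b b≢)))
    ... | refl = refl
    dart-injective t<L t′<L p q | a , a≢ , inj₁ refl | b , b≢ , inj₂ refl = contradiction ne
      (no-2-cycle (exc a a≢) (exc b b≢) pa pb)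
      where
      pa : c (first (exc a a≢)) ≡ b
      pa = trans p (leave (exc b b≢))
      pb : c (first (exc b b≢)) ≡ a
      pb = trans (sym (return (exc b b≢))) (trans (sym q) (enter (exc a a≢)))
      ne : a ≢ b
      ne a≡b = loopless _ (first<L (exc a a≢)) (trans pa (trans (sym a≡b) (sym (enter (exc a a≢)))))
    dart-injective t<L t′<L p q | a , a≢ , inj₂ refl | b , b≢ , inj₁ refl = contradiction ne
      (no-2-cycle (exc b b≢) (exc a a≢) pb pa)
      where
      pb : c (first (exc b b≢)) ≡ a
      pb = trans (sym p) (leave (exc a a≢))
      pa : c (first (exc a a≢)) ≡ b
      pa = trans (sym (return (exc a a≢))) (trans q (enter (exc b b≢)))
      ne : b ≢ a
      ne b≡a = loopless _ (first<L (exc b b≢)) (trans pb (trans (sym b≡a) (sym (enter (exc b b≢)))))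

    neighbours : Fin n → List (Fin n)
    neighbours = exits L 0

    ∈-neighbours⁻ : ∀ {v w} → w ∈ neighbours v → ∃ λ t → t < L × c t ≡ v × c (suc t) ≡ w
    ∈-neighbours⁻ m = let t , _ , t< , r = exits-∈⁻ L 0 m in t , subst (t <_) (ℕP.+-identityʳ L) t< , r

    ∈-neighbours⁺ : ∀ {t v} → t < L → c t ≡ v → c (suc t) ∈ neighbours v
    ∈-neighbours⁺ {t} t<L e = exits-∈⁺ L 0 e z≤n (subst (t <_) (sym (ℕP.+-identityʳ L)) t<L)

    -- The two ends of an excursion cross the same edge in opposite directions.
    reverse-dart : ∀ t → t < L → ∃ λ t′ → t′ < L × c t′ ≡ c (suc t) × c (suc t′) ≡ c t
    reverse-dart t t<L with cover t t<L
    ... | v , v≢ , inj₁ refl = let e = exc v v≢ in last e , last<L e , trans (leave e) (sym (enter e)) , return e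
    ... | v , v≢ , inj₂ refl = let e = exc v v≢ in first e , first<L e , sym (return e) , trans (enter e) (sym (leave e))

    exits-unique : ∀ j s {v} → j + s ≤ L → Unique (exits j s v)
    exits-unique zero s le = []
    exits-unique (suc j) s {v} le with c s ≟ᶠ v
    ... | no _ = exits-unique j (suc s) (subst (_≤ L) (sym (ℕP.+-suc j s)) le)
    ... | yes p = ¬Any⇒All¬ _ fresh ∷ exits-unique j (suc s) (subst (_≤ L) (sym (ℕP.+-suc j s)) le)
      where
      fresh : c (suc s) ∉ exits j (suc s) v
      fresh m = let t , s<t , t< , q , r = exits-∈⁻ j (suc s) m in
        ℕP.<⇒≢ s<t (dart-injective (ℕP.≤-trans (s≤s (ℕP.m≤n+m s j)) le)
          (ℕP.≤-trans t< (subst (_≤ L) (sym (ℕP.+-suc j s)) le)) (trans p (sym q)) (sym r))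

    neighbours-unique : ∀ v → Unique (neighbours v)
    neighbours-unique v = exits-unique L 0 (ℕP.≤-reflexive (ℕP.+-identityʳ L))

    neighbours-sym : ∀ u v → u ∈ neighbours v → v ∈ neighbours u
    neighbours-sym u v m with ∈-neighbours⁻ m
    ... | t , t<L , refl , refl with reverse-dart t t<L
    ... | t′ , t′<L , p , q = subst (_∈ neighbours u) q (∈-neighbours⁺ t′<L p)

    visited : ∀ v → ∃ λ t → t ≤ L × c t ≡ v
    visited v with v ≟ᶠ c L
    ... | yes refl = L , ℕP.≤-refl , refl
    ... | no v≢ = last (exc v v≢) , ℕP.<⇒≤ (last<L (exc v v≢)) , leave (exc v v≢)

    path-from-start : ∀ t → t ≤ L → ∀ {v} → Path neighbours (c t) v → Path neighbours (c 0) v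
    path-from-start zero le p = p
    path-from-start (suc t) le p = path-from-start t (ℕP.<⇒≤ le) (there (∈-neighbours⁺ le refl) p)

    path-to : ∀ t → t ≤ L → ∀ {v} → Path neighbours (c 0) v → Path neighbours (c t) v
    path-to zero le p = p
    path-to (suc t) le p = there (neighbours-sym _ _ (∈-neighbours⁺ le refl)) (path-to t (ℕP.<⇒≤ le) p)

    neighbours-connected : ∀ u v → Path neighbours u v
    neighbours-connected u v with visited u | visited v
    ... | t , le , refl | t′ , le′ , refl = path-to t le (path-from-start t′ le′ here)

    <L+0 : ∀ {t} → t < L → t < L + 0
    <L+0 {t} = subst (t <_) (sym (ℕP.+-identityʳ L))

    -- The step after the first entry is the first exit from `v`, and the last exit leads back to
    -- `c (first e)`; in the cyclic order the first exit follows the last.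
    next-after-first : ∀ {v} (e : Excursion v) → suc (first e) < L →
      CycNext (c (first e)) (c (suc (suc (first e)))) (neighbours v)
    next-after-first {v} e l = cycNext-wrap
      (proj₂ (exits-head L 0 (enter e)
        (avoids-snoc (before e) λ q → loopless _ (ℕP.<⇒≤ l) (trans q (sym (enter e)))) z≤n (<L+0 l)))
      (trans (proj₂ final) (cong (λ z → proj₁ final ++ [ z ]) (return e)))
      where
      final : ∃ λ l → neighbours v ≡ l ++ [ c (suc (last e)) ]
      final = exits-last L 0 (leave e)
        (subst (λ z → Avoids (suc (last e)) z v) (sym (ℕP.+-identityʳ L)) (after e)) z≤n (<L+0 (last<L e))

    -- By `during`, the parent is not visited between sending the walk to `v` and getting it back,
    -- so its next exit is listed right after `v`.
    next-after-last : ∀ {v} (e : Excursion v) → suc (last e) < L →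
      CycNext (c (last e)) (c (suc (suc (last e)))) (neighbours (c (first e)))
    next-after-last e l = consec-++⁺ _ (subst (λ z → Consec z (c (suc (suc (last e)))) (neighbours (c (first e))))
      (trans (enter e) (sym (leave e)))
      (exits-consec L 0 refl (return e)
        (avoids-snoc (during e) λ q → loopless _ (ℕP.<⇒≤ l) (trans q (sym (return e))))
        z≤n (ℕP.m<n⇒m<1+n (first<last e)) (<L+0 l)))

    neighbours-next : ∀ t → suc t < L → nextCW (neighbours (c (suc t))) (c t) ≡ c (suc (suc t))
    neighbours-next t l = nextCW-cycNext _ (neighbours-unique _) (cyc (cover t (ℕP.<⇒≤ l)))
      where
      cyc : (∃ λ v → Σ (v ≢ c L) λ v≢ → t ≡ first (exc v v≢) ⊎ t ≡ last (exc v v≢)) →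
        CycNext (c t) (c (suc (suc t))) (neighbours (c (suc t)))
      cyc (v , v≢ , inj₁ refl) = subst (λ z → CycNext (c t) (c (suc (suc t))) (neighbours z))
        (sym (enter (exc v v≢))) (next-after-first (exc v v≢) l)
      cyc (v , v≢ , inj₂ refl) = subst (λ z → CycNext (c t) (c (suc (suc t))) (neighbours z))
        (sym (return (exc v v≢))) (next-after-last (exc v v≢) l)

    module _ (0<L : 0 < L) (L≡ : L ≡ 2 * (n ∸ 1)) (rootN : suc (toℕ (c 0)) ≡ n) where

      tree : PlaneTree n
      tree = record
        { ρ = neighbours
        ; nodup = neighbours-unique
        ; noloop = λ v m → let t , t<L , p , q = ∈-neighbours⁻ m in loopless t t<L (trans p (sym q))
        ; symm = neighbours-sym
        ; nEdges = trans (cong sum (List.map-tabulate (λ v → v) (λ v → length (neighbours v)))) (trans (∑-exits L 0) L≡)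
        ; connected = neighbours-connected
        ; root = c 0
        ; rootIsN = rootN
        ; mark = c 1
        ; markAdj = ∈-neighbours⁺ 0<L refl
        }

      tree-walk : ∀ t → t < L → walkState tree t ≡ (c t , c (suc t))
      tree-walk zero l = refl
      tree-walk (suc t) l rewrite tree-walk t (ℕP.<⇒≤ l) = cong (c (suc t) ,_) (neighbours-next t l)

-- Factorizations of λₙ and tours

module Factorization {n : ℕ} (r : Fin n) (rootN : suc (toℕ r) ≡ n) where

  at-root⁻ : ∀ {k} → At k r → n ∣ ∣ k ∣
  at-root⁻ {k} at = subst (n ∣_) (cong ∣_∣ (ℤP.+-identityʳ k)) (raw (cong-trans at root≡0))
    where
    root≡0 : Congr n (label r) (+ 0)
    root≡0 = subst (λ z → Congr n z (+ 0)) (cong +_ (sym rootN)) (cong-shift (+ 0))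

  at-root⁺ : ∀ {k} → n ∣ ∣ k ∣ → At k r
  at-root⁺ {k} n∣k = cong-trans (congr (subst (n ∣_) (cong ∣_∣ (sym (ℤP.+-identityʳ k))) n∣k))
    (subst (λ z → Congr n (+ 0) z) (cong +_ (sym rootN)) (cong-sym (cong-shift (+ 0))))

  lam-root : ∀ {k} → At k r → lam n k ≡ k ℤ.- + (n * (n ∸ 1))
  lam-root {k} at = if-true (n ∣? ∣ k ∣) (at-root⁻ at)

  lam-other : ∀ {k} → ¬ At k r → lam n k ≡ k ℤ.+ + n
  lam-other {k} ¬at = if-false (n ∣? ∣ k ∣) (¬at ∘ at-root⁺)

  module _ (ℓ : ℕ) (ℓ≡ : ℓ ≡ 2 * (n ∸ 1))
    (c : ℕ → Fin n) (R : ℕ → Pair) (d : ℕ → ℕ) where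

    open Token c
    open Touring c ℓ
    open Excursion

    0<n : 0 < n
    0<n = subst (0 <_) rootN (s≤s z≤n)

    -- Two moves for each of the `n` vertices; the 2 on the left stands for the token, whose entry
    -- in the sum is 0.
    double : 2 + ℓ ≡ n * 2
    double = trans (cong (_+_ 2) ℓ≡) (trans (sym (ℕP.*-distribˡ-+ 2 1 (n ∸ 1)))
      (trans (cong (_*_ 2) (ℕP.m+[n∸m]≡n 0<n)) (ℕP.*-comm 2 n)))

    module _ (loopless : ∀ t → t < ℓ → c t ≢ c (suc t))
      (steps : ∀ t → t < ℓ → Step (R t) (c t) (c (suc t)) (d t))
      (fact : ∀ k → comp ℓ loopless R d steps ℓ 0 k ≡ lam n k) where

      open Step

      ℓ+0 : ℓ + 0 ≡ ℓ
      ℓ+0 = ℕP.+-identityʳ ℓ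

      -- The token is never raised, whereas `lam` raises every class but that of 0.
      token-root : c ℓ ≡ r
      token-root with c ℓ ≟ᶠ r
      ... | yes p = p
      ... | no ¬p = contradiction (ℤP.≤-<-trans (ℤP.≤-reflexive eq) lt) (ℤP.<-irrefl refl)
        where
        k = label (c ℓ)
        eq : k ℤ.+ + n ≡ k ℤ.- + total d ℓ 0
        eq = trans (sym (lam-other (¬p ∘ label-injective))) (trans (sym (fact k))
          (proj₁ (comp-token ℓ loopless R d steps ℓ 0 ℓ+0 cong-refl)))
        lt : k ℤ.- + total d ℓ 0 ℤ.< k ℤ.+ + n
        lt = ℤP.≤-<-trans (ℤP.i-j≤i k (+ total d ℓ 0))
          (subst (ℤ._< k ℤ.+ + n) (ℤP.+-identityʳ k) (ℤP.+-monoʳ-< k (ℤ.+<+ 0<n)))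

      start-root : c 0 ≡ r
      start-root = at-unique (proj₂ (comp-token ℓ loopless R d steps ℓ 0 ℓ+0 {k} (cong-reflexive (cong label (sym token-root)))))
        (subst (λ z → At z r) (sym (trans (fact k) (lam-root cong-refl)))
          (cong-intro (ℤ.- + (n ∸ 1)) (trans (cong (λ z → k ℤ.- z ℤ.- k) (ℤP.pos-* n (n ∸ 1))) (lem k (+ n) (+ (n ∸ 1))))))
        where
        k = label r
        lem : ∀ k x y → k ℤ.- x ℤ.* y ℤ.- k ≡ ℤ.- y ℤ.* x
        lem = solve-∀

      particle : ∀ {v} → v ≢ c ℓ → acc d ℓ 0 v ≡ n × pos ℓ 0 v ≡ v
      particle {v} v≢ =
        ℤP.+-injective (+-cancelˡ k _ _ (trans (sym e₁) (trans (fact k) lam≡)))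
        , at-unique at (subst (λ z → At z v) (sym (trans (fact k) lam≡)) (cong-shift k))
        where
        k = label v
        lam≡ = lam-other {k} (λ at → v≢ (trans (label-injective at) (sym token-root)))
        e₁ = proj₁ (comp-particle ℓ loopless R d steps ℓ 0 ℓ+0 {k} v≢ cong-refl)
        at = proj₂ (comp-particle ℓ loopless R d steps ℓ 0 ℓ+0 {k} v≢ cong-refl)

      two-moves : ∀ {v} → v ≢ c ℓ → ∀ ts → times ℓ 0 v ≡ ts → 2 ≤ length ts
      two-moves v≢ [] eq = contradiction 0<n
        (subst (λ z → ¬ 0 < z) (trans (cong (sum ∘ map d) (sym eq)) (proj₁ (particle v≢))) λ ())
      two-moves v≢ (k ∷ []) eq =
        let j , i , e₁ , p , q , _ = times-∷ ℓ 0 eq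
            k<ℓ = subst (suc k ≤_) (trans i ℓ+0) (ℕP.m≤n+m (suc k) j)
        in contradiction (trans (trans (sym p) (proj₁ (times-[] j (suc k) e₁))) (trans (sym (proj₂ (particle v≢))) q))
             (loopless k k<ℓ)
      two-moves v≢ (_ ∷ _ ∷ _) eq = s≤s (s≤s z≤n)

      exactly-two : ∀ {v} → v ≢ c ℓ → length (times ℓ 0 v) ≡ 2
      exactly-two {v} v≢ = sym (trans (sym (if-false (v ≟ᶠ c ℓ) v≢)) (trans (∑-tight le sums v)
        (trans (if-false (v ≟ᶠ c ℓ) v≢) (sum-map-1 (times ℓ 0 v)))))
        where
        two : Fin n → ℕ
        two v = if does (v ≟ᶠ c ℓ) then 0 else 2
        moves : Fin n → ℕ
        moves = accᵖ ℓ loopless (λ _ → 1) ℓ 0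
        le : ∀ v → two v ≤ moves v
        le v with v ≟ᶠ c ℓ
        ... | yes _ = z≤n
        ... | no v≢ = subst (2 ≤_) (sym (sum-map-1 (times ℓ 0 v))) (two-moves v≢ _ refl)
        sums : ∑ moves ≤ ∑ two
        sums = ℕP.≤-reflexive (trans (∑-accᵖ ℓ loopless (λ _ → 1) ℓ 0 ℓ+0) (trans (total-1 ℓ 0)
          (ℕP.+-cancelˡ-≡ 2 _ _ (trans double (sym (∑-except two (c ℓ) 2
            (if-true (c ℓ ≟ᶠ c ℓ) refl) λ v v≢ → if-false (v ≟ᶠ c ℓ) v≢))))))

      excursion : ∀ v → v ≢ c ℓ → Excursion v
      excursion v v≢ = build (times ℓ 0 v) refl (exactly-two v≢)
        where
        build : ∀ ts → times ℓ 0 v ≡ ts → length ts ≡ 2 → Excursion v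
        build (_ ∷ _ ∷ []) eq refl = proj₁ (times-excursion eq (proj₂ (particle v≢)))

      -- Deciding the equality anew yields a proof that may be used, as the irrelevant one may not.
      excursion-irr : ∀ v → .(v ≢ c ℓ) → Excursion v
      excursion-irr v v≢ with v ≟ᶠ c ℓ
      ... | yes p = ⊥-elim-irr (v≢ p)
      ... | no v≢′ = excursion v v≢′

      fact⇒tour : Tour
      fact⇒tour = record
        { loopless = loopless
        ; closed = trans start-root (sym token-root)
        ; exc = excursion-irr
        ; cover = λ t t<L → let v , v≢ , t∈ = times-cover ℓ loopless ℓ 0 ℓ+0 t z≤n t<L
                            in v , v≢ , either (subst (t ∈_) (proj₁ (excursion-times (excursion-irr v v≢))) t∈)
        }
        where
        either : ∀ {t a b : ℕ} → t ∈ a ∷ b ∷ [] → t ≡ a ⊎ t ≡ b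
        either (here e) = inj₁ e
        either (there (here e)) = inj₂ e

      d<n : ∀ t → t < ℓ → d t < n
      d<n t t<L with Tour.cover fact⇒tour t t<L
      ... | v , v≢ , which = bound which
        where
        e = excursion-irr v v≢
        sum≡ : d (first e) + (d (last e) + 0) ≡ n
        sum≡ = trans (cong (sum ∘ map d) (sym (proj₁ (excursion-times e)))) (proj₁ (particle v≢))
        bound : ∀ {t} → t ≡ first e ⊎ t ≡ last e → d t < n
        bound (inj₁ refl) = subst (d (first e) <_) sum≡ (ℕP.m<m+n (d (first e)) (ℕP.≤-trans (d>0 (steps _ (last<L e))) (ℕP.m≤m+n _ 0)))
        bound (inj₂ refl) = subst (d (last e) <_) sum≡ (ℕP.≤-<-trans (ℕP.m≤m+n _ 0)
          (ℕP.m<n+m (d (last e) + 0) (d>0 (steps _ (ℕP.<-trans (first<last e) (last<L e))))))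

    module _ (tour : Tour)
      (steps : ∀ t → t < ℓ → Step (R t) (c t) (c (suc t)) (d t))
      (d<n : ∀ t → t < ℓ → d t < n) (start : c 0 ≡ r) where

      open Tour tour

      excursion-length : ∀ {v} → v ≢ c ℓ → acc d ℓ 0 v ≡ n
      excursion-length {v} v≢ = trans (cong (sum ∘ map d) (proj₁ (excursion-times e)))
        (trans (cong (_+_ (d (first e))) (ℕP.+-identityʳ (d (last e))))
          (opposite-sum (steps _ first<L)
            (subst (λ z → Step (R (last e)) z (c (first e)) (d (last e))) (trans (leave e) (sym (enter e)))
              (subst (λ z → Step (R (last e)) (c (last e)) z (d (last e))) (return e) (steps _ (last<L e))))
            (d<n _ first<L) (d<n _ (last<L e))))
        where
        e = exc v v≢
        first<L = ℕP.<-trans (first<last e) (last<L e)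

      total-length : total d ℓ 0 ≡ n * (n ∸ 1)
      total-length = ℕP.+-cancelˡ-≡ n _ _ (trans (trans (cong (_+_ n) (sym (∑-accᵖ ℓ loopless d ℓ 0 (ℕP.+-identityʳ ℓ))))
        (∑-except (accᵖ ℓ loopless d ℓ 0) (c ℓ) n (if-true (c ℓ ≟ᶠ c ℓ) refl)
          λ v v≢ → trans (if-false (v ≟ᶠ c ℓ) v≢) (excursion-length v≢)))
        (trans (cong (_*_ n) (sym (ℕP.m+[n∸m]≡n 0<n))) (ℕP.*-suc n (n ∸ 1))))

      instance
        n≢0 : ℕ.NonZero n
        n≢0 = ℕ.>-nonZero 0<n

      tour⇒fact : ∀ k → comp ℓ loopless R d steps ℓ 0 k ≡ lam n k
      tour⇒fact k with class {n} k
      ... | v , kv with v ≟ᶠ c ℓ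
      ... | yes refl = trans (proj₁ (comp-token ℓ loopless R d steps ℓ 0 (ℕP.+-identityʳ ℓ) kv))
        (trans (cong (λ z → k ℤ.- + z) total-length) (sym (lam-root (subst (At k) (trans (sym closed) start) kv))))
      ... | no v≢ = trans (proj₁ (comp-particle ℓ loopless R d steps ℓ 0 (ℕP.+-identityʳ ℓ) v≢ kv))
        (trans (cong (λ z → k ℤ.+ + z) (excursion-length v≢))
          (sym (lam-other λ kr → v≢ (at-unique kv (subst (At k) (trans (sym start) closed) kr)))))

-- Pigeonhole principles and searches

pigeonhole-∈ : ∀ {A : Set} {m} (ys : List A) (f : Fin m → A) → (∀ i → f i ∈ ys) → length ys < m →
  ∃₂ λ i j → i <ᶠ j × f i ≡ f j
pigeonhole-∈ ys f mem l =
  let i , j , i<j , e = FinP.pigeonhole l (index ∘ mem)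
  in i , j , i<j , trans (lookup-index (mem i)) (trans (cong (lookupᴸ ys) e) (sym (lookup-index (mem j))))

lookup-unique-injective : ∀ {A : Set} {xs : List A} → Unique xs → ∀ i j → lookupᴸ xs i ≡ lookupᴸ xs j → i ≡ j
lookup-unique-injective {xs = _ ∷ _} u zero zero e = refl
lookup-unique-injective {xs = _ ∷ xs} (x∉ ∷ u) zero (suc j) e = contradiction (subst (_∈ xs) (sym e) (∈-lookup j)) (All¬⇒¬Any x∉)
lookup-unique-injective {xs = _ ∷ xs} (x∉ ∷ u) (suc i) zero e = contradiction (subst (_∈ xs) e (∈-lookup i)) (All¬⇒¬Any x∉)
lookup-unique-injective {xs = _ ∷ _} (x∉ ∷ u) (suc i) (suc j) e = cong suc (lookup-unique-injective u i j e)

unique-⊆-length : ∀ {A : Set} {xs ys : List A} → Unique xs → (∀ {x} → x ∈ xs → x ∈ ys) → length xs ≤ length ys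
unique-⊆-length {xs = xs} {ys} u sub with length xs ℕ.≤? length ys
... | yes l = l
... | no ¬l =
  let i , j , i<j , e = pigeonhole-∈ ys (lookupᴸ xs) (λ i → sub (∈-lookup i)) (ℕP.≰⇒> ¬l)
  in contradiction (cong toℕ (lookup-unique-injective u i j e)) (ℕP.<⇒≢ i<j)

length-concatMap : ∀ {A B : Set} (f : A → List B) xs → length (concatMap f xs) ≡ sum (map (length ∘ f) xs)
length-concatMap f [] = refl
length-concatMap f (x ∷ xs) = trans (List.length-++ (f x)) (cong (_+_ (length (f x))) (length-concatMap f xs))

least : ∀ {P : ℕ → Set} → (∀ m → Dec (P m)) → ∀ m → P m → ∃ λ k → P k × (∀ i → i < k → ¬ P i)
least P? m pm with P? 0
... | yes p = 0 , p , λ i ()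
least P? zero pm | no ¬p = contradiction pm ¬p
least {P} P? (suc m) pm | no ¬p with least (P? ∘ suc) m pm
... | k , pk , min = suc k , pk , λ where
  zero _ → ¬p
  (suc i) (s≤s i<k) → min i i<k

-- Scans upwards from `a` for the first failure of `P`; `t` is the index just before it.
last-true : ∀ {P : ℕ → Set} → (∀ m → Dec (P m)) → ∀ i a → P a → ¬ P (i + a) →
  ∃ λ t → a ≤ t × t < i + a × P t × ¬ P (suc t)
last-true P? zero a pa ¬pb = contradiction pa ¬pb
last-true {P} P? (suc i) a pa ¬pb with P? (suc a)
... | no ¬p = a , ℕP.≤-refl , s≤s (ℕP.m≤n+m a i) , pa , ¬p
... | yes p =
  let t , l , u , pt , ¬pt = last-true P? i (suc a) p (subst (¬_ ∘ P) (sym (ℕP.+-suc i a)) ¬pb)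
  in t , ℕP.<⇒≤ l , subst (t <_) (ℕP.+-suc i a) u , pt , ¬pt

crossing : ∀ {P : ℕ → Set} → (∀ m → Dec (P m)) → ∀ {a b} → a ≤ b → P a → ¬ P b →
  ∃ λ t → a ≤ t × t < b × P t × ¬ P (suc t)
crossing {P} P? {a} {b} a≤b pa ¬pb =
  let t , l , u , r = last-true P? (b ∸ a) a pa (subst (¬_ ∘ P) (sym e) ¬pb) in t , l , subst (t <_) e u , r
  where
  e : b ∸ a + a ≡ b
  e = ℕP.m∸n+n≡m a≤b

crossing-up : ∀ {P : ℕ → Set} → (∀ m → Dec (P m)) → ∀ {a b} → a ≤ b → ¬ P a → P b →
  ∃ λ t → a ≤ t × t < b × ¬ P t × P (suc t)
crossing-up P? a≤b ¬pa pb with crossing (¬? ∘ P?) a≤b ¬pa (λ ¬p → ¬p pb)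
... | t , l , u , ¬pt , ¬¬p with P? (suc t)
... | yes p = t , l , u , ¬pt , p
... | no ¬p = contradiction ¬p ¬¬p

-- The walk around a plane tree

module Walk {n : ℕ} (T : PlaneTree n) where

  open PlaneTree T

  ℓ : ℕ
  ℓ = 2 * (n ∸ 1)

  ∑-degree : ∑ (length ∘ ρ) ≡ ℓ
  ∑-degree = trans (sym (cong sum (List.map-tabulate (λ v → v) (length ∘ ρ)))) nEdges

  -- Distance to the root and the spanning tree of parents

  Within : ℕ → Fin n → Set
  Within zero v = v ≡ root
  Within (suc m) v = Within m v ⊎ Any (Within m) (ρ v)

  within? : ∀ m v → Dec (Within m v)
  within? zero v = v ≟ᶠ root
  within? (suc m) v = within? m v ⊎-dec any? (within? m) (ρ v)

  path⇒within : ∀ {v} → Path ρ v root → ∃ λ m → Within m v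
  path⇒within here = 0 , refl
  path⇒within (there w∈ p) = let m , q = path⇒within p in suc m , inj₂ (lose w∈ q)

  distance : ∀ v → ∃ λ m → Within m v × (∀ i → i < m → ¬ Within i v)
  distance v = let m , p = path⇒within (connected v root) in least (λ m → within? m v) m p

  rank : Fin n → ℕ
  rank v = proj₁ (distance v)

  -- Minimality rules out the first summand of `Within`, so the distance is realised through a
  -- neighbour.
  closer : ∀ v → v ≢ root → ∃ λ u → u ∈ ρ v × rank u < rank v
  closer v v≢ with distance v
  ... | zero , p , _ = contradiction p v≢
  ... | suc m , inj₁ p , min = contradiction p (min m ℕP.≤-refl)
  ... | suc m , inj₂ any , _ with find any
  ... | u , u∈ , w = u , u∈ , s≤s (ℕP.≮⇒≥ λ l → proj₂ (proj₂ (distance u)) m l w)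

  -- The decision is an argument, so that lemmas can split on it directly.
  parentBy : ∀ v → Dec (v ≡ root) → Fin n
  parentBy v (yes _) = root
  parentBy v (no v≢) = proj₁ (closer v v≢)

  parent : Fin n → Fin n
  parent v = parentBy v (v ≟ᶠ root)

  parentBy-closer : ∀ {v} d → v ≢ root → parentBy v d ∈ ρ v × rank (parentBy v d) < rank v
  parentBy-closer (yes p) v≢ = contradiction p v≢
  parentBy-closer (no v≢) _ = proj₂ (closer _ v≢)

  parent-∈ : ∀ {v} → v ≢ root → parent v ∈ ρ v
  parent-∈ {v} = proj₁ ∘ parentBy-closer (v ≟ᶠ root)

  rank-parent-< : ∀ {v} → v ≢ root → rank (parent v) < rank v
  rank-parent-< {v} = proj₂ ∘ parentBy-closer (v ≟ᶠ root)

  parent-root : parent root ≡ root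
  parent-root = by (root ≟ᶠ root)
    where
    by : ∀ d → parentBy root d ≡ root
    by (yes _) = refl
    by (no ¬p) = contradiction refl ¬p

  rank-parent-≤ : ∀ v → rank (parent v) ≤ rank v
  rank-parent-≤ v = by (v ≟ᶠ root)
    where
    by : ∀ d → rank (parentBy v d) ≤ rank v
    by (yes refl) = ℕP.≤-refl
    by (no v≢) = ℕP.<⇒≤ (proj₂ (proj₂ (closer v v≢)))

  Dart : Set
  Dart = Fin n × Fin n

  swap : Dart → Dart
  swap (u , w) = w , u

  IsTreeDart : Dart → Set
  IsTreeDart (u , w) = (u ≢ root × w ≡ parent u) ⊎ (w ≢ root × u ≡ parent w)

  isTreeDart? : ∀ e → Dec (IsTreeDart e)
  isTreeDart? (u , w) = (¬? (u ≟ᶠ root) ×-dec (w ≟ᶠ parent u)) ⊎-dec (¬? (w ≟ᶠ root) ×-dec (u ≟ᶠ parent w))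

  darts : List Dart
  darts = concatMap (λ u → map (u ,_) (ρ u)) (allFin n)

  length-darts : length darts ≡ ℓ
  length-darts = trans (length-concatMap _ (allFin n))
    (trans (cong sum (List.map-cong (λ u → List.length-map (u ,_) (ρ u)) (allFin n))) nEdges)

  ∈-darts : ∀ {u w} → w ∈ ρ u → (u , w) ∈ darts
  ∈-darts {u} w∈ = ∈-concatMap⁺ _ (lose (∈-allFin u) (∈-map⁺ (u ,_) w∈))

  0<n : 0 < n
  0<n = subst (0 <_) rootIsN (s≤s z≤n)

  ℓ<n*2 : ℓ < n * 2
  ℓ<n*2 = subst (ℓ <_) (ℕP.*-comm 2 n) (ℕP.*-monoʳ-< 2 (ℕP.≤-reflexive (ℕP.m+[n∸m]≡n 0<n)))

  -- A dart outside the spanning tree would, with its reverse, complete the 2(n - 1) tree darts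
  -- to 2n distinct darts.
  module _ {e : Dart} (e∈ : proj₂ e ∈ ρ (proj₁ e)) (¬tree : ¬ IsTreeDart e) where

    -- The root has no parent, so its slot is free for the extra dart.
    upDartBy : ∀ v → Dec (v ≡ root) → Dart
    upDartBy v (yes _) = e
    upDartBy v (no _) = v , parent v

    upDart : Fin n → Dart
    upDart v = upDartBy v (v ≟ᶠ root)

    orient : Fin 2 → Dart → Dart
    orient zero e = e
    orient (suc zero) e = swap e

    upDart-∈ : ∀ v b → orient b (upDart v) ∈ darts
    upDart-∈ v b = by (v ≟ᶠ root) b
      where
      by : ∀ d b → orient b (upDartBy v d) ∈ darts
      by (yes _) zero = ∈-darts e∈
      by (no v≢) zero = ∈-darts (parent-∈ v≢)
      by (yes _) (suc zero) = ∈-darts (symm _ _ e∈)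
      by (no v≢) (suc zero) = ∈-darts (symm _ _ (parent-∈ v≢))

    upDart-injective : ∀ v v′ → upDart v ≡ upDart v′ → v ≡ v′
    upDart-injective v v′ = by (v ≟ᶠ root) (v′ ≟ᶠ root)
      where
      by : ∀ d d′ → upDartBy v d ≡ upDartBy v′ d′ → v ≡ v′
      by (yes p) (yes p′) q = trans p (sym p′)
      by (no _) (no _) q = cong proj₁ q
      by (yes _) (no v≢) refl = contradiction (inj₁ (v≢ , refl)) ¬tree
      by (no v≢) (yes _) refl = contradiction (inj₁ (v≢ , refl)) ¬tree

    upDart-≢-swap : ∀ v v′ → upDart v ≢ swap (upDart v′)
    upDart-≢-swap v v′ = by (v ≟ᶠ root) (v′ ≟ᶠ root)
      where
      by : ∀ d d′ → upDartBy v d ≢ swap (upDartBy v′ d′)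
      by (yes _) (yes _) q = noloop _ (subst (_∈ ρ (proj₁ e)) (sym (cong proj₁ q)) e∈)
      by (yes _) (no v≢) refl = ¬tree (inj₂ (v≢ , refl))
      by (no v≢) (yes _) q = ¬tree (inj₂ (subst (_≢ root) (cong proj₁ q) v≢ ,
        trans (sym (cong proj₂ q)) (cong parent (cong proj₁ q))))
      -- Two vertices cannot be each other's parents, since the rank drops towards a parent.
      by (no v≢) (no v′≢) q = ℕP.<-asym
        (subst (λ z → rank z < rank v) (cong proj₂ q) (rank-parent-< v≢))
        (subst (λ z → rank z < rank v′) (sym (cong proj₁ q)) (rank-parent-< v′≢))

    nonTree⇒⊥ : ⊥
    nonTree⇒⊥ =
      let i , j , i<j , q = pigeonhole-∈ darts f (λ i → upDart-∈ (v i) (b i)) (subst (_< n * 2) (sym length-darts) ℓ<n*2)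
      in ℕP.<⇒≢ i<j (cong toℕ (trans (sym (FinP.combine-remQuot {n} 2 i))
           (trans (cong (uncurry combine) (inj _ _ _ _ q)) (FinP.combine-remQuot {n} 2 j))))
      where
      v : Fin (n * 2) → Fin n
      v i = proj₁ (remQuot {n} 2 i)
      b : Fin (n * 2) → Fin 2
      b i = proj₂ (remQuot {n} 2 i)
      f : Fin (n * 2) → Dart
      f i = orient (b i) (upDart (v i))
      inj : ∀ v b v′ b′ → orient b (upDart v) ≡ orient b′ (upDart v′) → (v , b) ≡ (v′ , b′)
      inj v zero v′ zero q = cong (_, zero) (upDart-injective v v′ q)
      inj v (suc zero) v′ (suc zero) q = cong (_, suc zero) (upDart-injective v v′ (cong swap q))
      inj v zero v′ (suc zero) q = contradiction q (upDart-≢-swap v v′)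
      inj v (suc zero) v′ zero q = contradiction (sym q) (upDart-≢-swap v′ v)

  treeDart : ∀ {u w} → w ∈ ρ u → IsTreeDart (u , w)
  treeDart {u} {w} w∈ with isTreeDart? (u , w)
  ... | yes p = p
  ... | no ¬p = ⊥-elim (nonTree⇒⊥ w∈ ¬p)

  ancestor : ℕ → Fin n → Fin n
  ancestor zero v = v
  ancestor (suc m) v = ancestor m (parent v)

  ancestor-root : ∀ m → ancestor m root ≡ root
  ancestor-root zero = refl
  ancestor-root (suc m) = trans (cong (ancestor m) parent-root) (ancestor-root m)

  rank-ancestor : ∀ m v → rank (ancestor m v) ≤ rank v
  rank-ancestor zero v = ℕP.≤-refl
  rank-ancestor (suc m) v = ℕP.≤-trans (rank-ancestor m (parent v)) (rank-parent-≤ v)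

  module Branch (i : Fin n) (i≢root : i ≢ root) where

    -- The side of `i` when the edge from `i` to its parent is removed.
    Below : Fin n → Set
    Below v = ∃ λ m → ancestor m v ≡ i

    -- `Below` puts no bound on the number of parent steps; the falling rank makes the search
    -- finite.
    below? : ∀ v → Dec (Below v)
    below? v = search (rank v) v ℕP.≤-refl
      where
      ¬root : ∀ {v} → v ≡ root → ¬ Below v
      ¬root refl (m , e) = i≢root (trans (sym e) (ancestor-root m))
      step : ∀ {v} → Dec (v ≡ i) → Dec (v ≡ root) → (v ≢ root → Dec (Below (parent v))) → Dec (Below v)
      step (yes p) _ _ = yes (0 , p)
      step (no _) (yes p) _ = no (¬root p)
      step (no v≢i) (no v≢root) next with next v≢root
      ... | yes (m , e) = yes (suc m , e)
      ... | no ¬p = no λ { (zero , e) → v≢i e ; (suc m , e) → ¬p (m , e) }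
      search : ∀ k v → rank v ≤ k → Dec (Below v)
      search zero v le = step (v ≟ᶠ i) (v ≟ᶠ root) λ v≢ →
        contradiction (ℕP.≤-trans (rank-parent-< v≢) le) λ ()
      search (suc k) v le = step (v ≟ᶠ i) (v ≟ᶠ root) λ v≢ →
        search k (parent v) (ℕP.≤-pred (ℕP.≤-trans (rank-parent-< v≢) le))

    below-self : Below i
    below-self = 0 , refl

    ¬below-root : ¬ Below root
    ¬below-root (m , e) = i≢root (trans (sym e) (ancestor-root m))

    ¬below-parent : ¬ Below (parent i)
    ¬below-parent (m , e) = ℕP.<⇒≱ (rank-parent-< i≢root) (subst (λ z → rank z ≤ rank (parent i)) e (rank-ancestor m (parent i)))

    -- The bridge property: a dart to a parent stays in the branch unless it starts at `i`, and a
    -- dart to a child never leaves it.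
    leaving : ∀ {u w} → w ∈ ρ u → Below u → ¬ Below w → (u , w) ≡ (i , parent i)
    leaving w∈ bu ¬bw with treeDart w∈
    leaving w∈ (zero , refl) ¬bw | inj₁ (_ , refl) = refl
    leaving w∈ (suc m , e) ¬bw | inj₁ (_ , refl) = contradiction (m , e) ¬bw
    leaving w∈ (m , e) ¬bw | inj₂ (_ , refl) = contradiction (suc m , e) ¬bw

    entering : ∀ {u w} → w ∈ ρ u → ¬ Below u → Below w → (u , w) ≡ (parent i , i)
    entering w∈ ¬bu bw = cong swap (leaving (symm _ _ w∈) bw ¬bu)

  -- The walk as a sequence of darts, and its period

  walk : ℕ → Dart
  walk = walkState T

  at : ℕ → Fin n
  at = proj₁ ∘ walk

  walk-∈ : ∀ t → at (suc t) ∈ ρ (at t)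
  walk-∈ zero = markAdj
  walk-∈ (suc t) = nextCW-∈ (ρ (at (suc t))) (nodup _) (symm _ _ (walk-∈ t))

  -- Turning can be undone, because `nextCW` is injective on a list without repetitions; so a
  -- repeated dart can be traced back to time 0.
  walk-suc-injective : ∀ s t → walk (suc s) ≡ walk (suc t) → walk s ≡ walk t
  walk-suc-injective s t e = cong₂ _,_ (nextCW-injective (ρ (at (suc t))) (nodup _)
      (subst (λ z → at s ∈ ρ z) (cong proj₁ e) (symm _ _ (walk-∈ s))) (symm _ _ (walk-∈ t))
      (trans (cong (λ z → nextCW (ρ z) (at s)) (sym (cong proj₁ e))) (cong proj₂ e)))
    (cong proj₁ e)

  walk-+-injective : ∀ i s t → walk (i + s) ≡ walk (i + t) → walk s ≡ walk t
  walk-+-injective zero s t e = e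
  walk-+-injective (suc i) s t e = walk-+-injective i s t (walk-suc-injective (i + s) (i + t) e)

  walk-return : ∀ {i j} → i ≤ j → walk i ≡ walk j → walk (j ∸ i) ≡ walk 0
  walk-return {i} {j} i≤j e = walk-+-injective i (j ∸ i) 0
    (trans (cong walk (ℕP.m+[n∸m]≡n i≤j)) (trans (sym e) (cong walk (sym (ℕP.+-identityʳ i)))))

  -- Any positive period is allowed: the bound `ℓ≤p` serves both for the period found by pigeonhole
  -- and for refuting an early repetition.
  module Period (p : ℕ) (0<p : 0 < p) (periodic : walk p ≡ walk 0) where

    walk-+p : ∀ t → walk (t + p) ≡ walk t
    walk-+p zero = periodic
    walk-+p (suc t) = cong (λ (u , w) → w , nextCW (ρ w) u) (walk-+p t)

    walk-+*p : ∀ q t → walk (t + q * p) ≡ walk t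
    walk-+*p zero t = cong walk (ℕP.+-identityʳ t)
    walk-+*p (suc q) t = trans (cong walk (sym (ℕP.+-assoc t p (q * p))))
      (trans (walk-+*p q (t + p)) (walk-+p t))

    instance
      p≢0 : ℕ.NonZero p
      p≢0 = ℕ.>-nonZero 0<p

    Visited : Fin n → Fin n → Set
    Visited u w = ∃ λ t → walk t ≡ (u , w)

    visited-before : ∀ {u w} → Visited u w → ∃ λ t → t < p × walk t ≡ (u , w)
    visited-before (t , e) = t % p , m%n<n t p ,
      trans (trans (sym (walk-+*p (t / p) (t % p))) (cong walk (sym (m≡m%n+[m/n]*n t p)))) e

    t<t+p : ∀ t → suc t ≤ t + p
    t<t+p t = subst (_≤ t + p) (ℕP.+-comm t 1) (ℕP.+-monoʳ-≤ t 0<p)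

    -- A periodic walk entering the branch of i has to leave it again, and conversely.
    visited-parent : ∀ {i} → i ≢ root → Visited (parent i) i → Visited i (parent i)
    visited-parent {i} i≢ (t , e) =
      let s , _ , _ , b , ¬b = crossing (below? ∘ at) (t<t+p t)
            (subst Below (sym (cong proj₂ e)) below-self)
            (subst (¬_ ∘ Below) (sym (cong proj₁ (trans (walk-+p t) e))) ¬below-parent)
      in s , leaving (walk-∈ s) b ¬b
      where open Branch i i≢

    visited-child : ∀ {i} → i ≢ root → Visited i (parent i) → Visited (parent i) i
    visited-child {i} i≢ (t , e) =
      let s , _ , _ , ¬b , b = crossing-up (below? ∘ at) (t<t+p t)
            (subst (¬_ ∘ Below) (sym (cong proj₂ e)) ¬below-parent)
            (subst Below (sym (cong proj₁ (trans (walk-+p t) e))) below-self)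
      in s , entering (walk-∈ s) ¬b b
      where open Branch i i≢

    visited-swap : ∀ {u w} → Visited u w → Visited w u
    visited-swap {u} {w} vis@(t , refl) with treeDart (walk-∈ t)
    ... | inj₁ (u≢ , w≡) = subst (λ z → Visited z u) (sym w≡) (visited-child u≢ (subst (Visited u) w≡ vis))
    ... | inj₂ (w≢ , u≡) = subst (Visited w) (sym u≡) (visited-parent w≢ (subst (λ z → Visited z w) u≡ vis))

    -- After the reverse of a visited dart the walk turns to the next neighbour of `u`, so the
    -- visited exits are closed under the cyclic order at `u`.
    visited-around : ∀ {u w} → w ∈ ρ u → Visited u w → ∀ {w′} → w′ ∈ ρ u → Visited u w′
    visited-around {u} = cycNext-covers (Visited u) (ρ u) λ x y cyc vis →
      let t , e = visited-swap vis
      in suc t , trans (cong (λ (a , b) → b , nextCW (ρ b) a) e) (cong (u ,_) (nextCW-cycNext (ρ u) (nodup u) cyc))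

    visited-all : ∀ {u w} → w ∈ ρ u → Visited u w
    visited-all {u} = along (connected root u) (visited-around markAdj (0 , refl))
      where
      along : ∀ {x y} → Path ρ x y → (∀ {w} → w ∈ ρ x → Visited x w) → ∀ {w} → w ∈ ρ y → Visited y w
      along here vis = vis
      along (there z∈ path) vis = along path (visited-around (symm _ _ z∈) (visited-swap (vis z∈)))

    open Touring at p using (exits; exits-∈⁺; ∑-exits)

    -- Within one period every neighbour of `v` occurs among the exits from `v`; summed over `v`,
    -- the degrees give `ℓ` and the exits `p`.
    ℓ≤p : ℓ ≤ p
    ℓ≤p = subst (_≤ p) ∑-degree (ℕP.≤-trans
      (∑-mono λ v → unique-⊆-length {ys = exits p 0 v} (nodup v) λ w∈ →
        let t , t<p , e = visited-before (visited-all w∈)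
        in subst (_∈ exits p 0 v) (cong proj₂ e) (exits-∈⁺ p 0 (cong proj₁ e) z≤n (subst (t <_) (sym (ℕP.+-identityʳ p)) t<p)))
      (ℕP.≤-reflexive (∑-exits p 0)))

  -- Among `ℓ + 1` times two show the same one of the `ℓ` darts; their difference is a period of at
  -- most `ℓ`, hence equal to `ℓ`.
  walk-closed : walk ℓ ≡ walk 0
  walk-closed =
    let i , j , i<j , e = pigeonhole-∈ darts (walk ∘ toℕ {suc ℓ}) (λ i → ∈-darts (walk-∈ (toℕ i)))
          (s≤s (ℕP.≤-reflexive length-darts))
        ret = walk-return (ℕP.<⇒≤ i<j) e
        p≤ℓ = ℕP.≤-trans (ℕP.m∸n≤m (toℕ j) (toℕ i)) (ℕP.≤-pred (FinP.toℕ<n j))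
    in trans (cong walk (ℕP.≤-antisym (Period.ℓ≤p _ (ℕP.m<n⇒0<n∸m i<j) ret) p≤ℓ)) ret

  walk-injective-< : ∀ {s t} → s < t → t < ℓ → walk s ≢ walk t
  walk-injective-< {s} {t} s<t t<ℓ e = ℕP.<⇒≱ (ℕP.≤-<-trans (ℕP.m∸n≤m t s) t<ℓ)
    (Period.ℓ≤p _ (ℕP.m<n⇒0<n∸m s<t) (walk-return (ℕP.<⇒≤ s<t) e))

  walk-injective : ∀ {s t} → s < ℓ → t < ℓ → walk s ≡ walk t → s ≡ t
  walk-injective {s} {t} s<ℓ t<ℓ e with ℕP.<-cmp s t
  ... | tri< l _ _ = contradiction e (walk-injective-< l t<ℓ)
  ... | tri≈ _ q _ = q
  ... | tri> _ _ l = contradiction (sym e) (walk-injective-< l s<ℓ)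

  -- The walk as a tour

  module _ (0<ℓ : 0 < ℓ) where

    open Period ℓ 0<ℓ walk-closed using (visited-all; visited-before)

    abstract
      -- `abstract` keeps the construction of the time from unfolding.
      dart-time : ∀ {u w} → w ∈ ρ u → ∃ λ t → t < ℓ × walk t ≡ (u , w)
      dart-time = visited-before ∘ visited-all

    open Touring at ℓ
    open Excursion

    module _ (v : Fin n) (v≢root : v ≢ root) {t↓ t↑ : ℕ} (t↓<ℓ : t↓ < ℓ) (t↑<ℓ : t↑ < ℓ)
      (walk↓ : walk t↓ ≡ (parent v , v)) (walk↑ : walk t↑ ≡ (v , parent v)) where

      open Branch v v≢root

      -- The walk starts and ends outside the branch, so a time inside lies between an entry and an
      -- exit; as each dart occurs once, these are at `t↓` and `t↑`.
      below-time : ∀ {s} → s ≤ ℓ → Below (at s) → t↓ < s × s ≤ t↑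
      below-time {s} s≤ℓ b =
        let t , _ , t<s , ¬b₁ , b₂ = crossing-up (below? ∘ at) z≤n ¬below-root b
            t′ , s≤t′ , t′<ℓ , b₃ , ¬b₄ = crossing (below? ∘ at) s≤ℓ b
              (subst (¬_ ∘ Below) (sym (cong proj₁ walk-closed)) ¬below-root)
        in subst (_< s) (walk-injective (ℕP.<-≤-trans t<s s≤ℓ) t↓<ℓ (trans (entering (walk-∈ t) ¬b₁ b₂) (sym walk↓))) t<s
         , subst (s ≤_) (walk-injective t′<ℓ t↑<ℓ (trans (leaving (walk-∈ t′) b₃ ¬b₄) (sym walk↑))) s≤t′

      -- The only way out of the branch is the dart at time `t↑`.
      time-below : ∀ {s} → t↓ < s → s ≤ t↑ → Below (at s)
      time-below {s} l u with below? (at s)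
      ... | yes b = b
      ... | no ¬b =
        let t , _ , t<s , b , ¬b′ = crossing (below? ∘ at) l (subst Below (sym (cong proj₂ walk↓)) below-self) ¬b
            t≡ = walk-injective (ℕP.<-trans (ℕP.<-≤-trans t<s u) t↑<ℓ) t↑<ℓ
                   (trans (leaving (walk-∈ t) b ¬b′) (sym walk↑))
        in contradiction (ℕP.<-≤-trans t<s u) (ℕP.<-irrefl t≡)

      walk-excursion : Excursion v
      walk-excursion = record
        { first = t↓
        ; last = t↑
        ; first<last = proj₁ (below-time (ℕP.<⇒≤ t↑<ℓ) (subst Below (sym (cong proj₁ walk↑)) below-self))
        ; last<L = t↑<ℓ
        ; enter = cong proj₂ walk↓
        ; leave = cong proj₁ walk↑
        ; return = trans (cong proj₂ walk↑) (sym (cong proj₁ walk↓))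
        ; before = λ u _ u<t e → ℕP.<-asym u<t
            (proj₁ (below-time (ℕP.<⇒≤ (ℕP.<-trans u<t t↓<ℓ)) (subst Below (sym e) below-self)))
        ; during = λ u l u<t e → ¬below-parent (subst Below (trans e (cong proj₁ walk↓)) (time-below l (ℕP.<⇒≤ u<t)))
        ; after = λ u l u<ℓ e → ℕP.<⇒≱ l (proj₂ (below-time (ℕP.<⇒≤ u<ℓ) (subst Below (sym e) below-self)))
        }

    time↓ : ∀ {v} → v ≢ root → ∃ λ t → t < ℓ × walk t ≡ (parent v , v)
    time↓ v≢ = dart-time (symm _ _ (parent-∈ v≢))

    time↑ : ∀ {v} → v ≢ root → ∃ λ t → t < ℓ × walk t ≡ (v , parent v)
    time↑ v≢ = dart-time (parent-∈ v≢)

    ℓ-root : at ℓ ≡ root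
    ℓ-root = cong proj₁ walk-closed

    excursionBy : ∀ v → Dec (v ≡ root) → .(v ≢ at ℓ) → Excursion v
    excursionBy v (yes p) v≢ = ⊥-elim-irr (v≢ (trans p (sym ℓ-root)))
    excursionBy v (no v≢) _ = walk-excursion v v≢
      (proj₁ (proj₂ (time↓ v≢))) (proj₁ (proj₂ (time↑ v≢))) (proj₂ (proj₂ (time↓ v≢))) (proj₂ (proj₂ (time↑ v≢)))

    excursion : ∀ v → .(v ≢ at ℓ) → Excursion v
    excursion v = excursionBy v (v ≟ᶠ root)

    excursion-first : ∀ {t} v (v≢ : v ≢ at ℓ) → t < ℓ → walk t ≡ (parent v , v) → t ≡ first (excursion v v≢)
    excursion-first {t} v v≢ t<ℓ e = by (v ≟ᶠ root)
      where
      by : ∀ d → t ≡ first (excursionBy v d v≢)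
      by (yes p) = contradiction (trans p (sym ℓ-root)) v≢
      by (no v≢root) = walk-injective t<ℓ (proj₁ (proj₂ (time↓ v≢root))) (trans e (sym (proj₂ (proj₂ (time↓ v≢root)))))

    excursion-last : ∀ {t} v (v≢ : v ≢ at ℓ) → t < ℓ → walk t ≡ (v , parent v) → t ≡ last (excursion v v≢)
    excursion-last {t} v v≢ t<ℓ e = by (v ≟ᶠ root)
      where
      by : ∀ d → t ≡ last (excursionBy v d v≢)
      by (yes p) = contradiction (trans p (sym ℓ-root)) v≢
      by (no v≢root) = walk-injective t<ℓ (proj₁ (proj₂ (time↑ v≢root))) (trans e (sym (proj₂ (proj₂ (time↑ v≢root)))))

    at-loopless : ∀ t → at t ≢ at (suc t)
    at-loopless t e = noloop _ (subst (_∈ ρ (at t)) (sym e) (walk-∈ t))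

    walk-tour : Tour
    walk-tour = record
      { loopless = λ t _ → at-loopless t
      ; closed = sym ℓ-root
      ; exc = excursion
      ; cover = cover
      }
      where
      cover : ∀ t → t < ℓ → ∃ λ v → Σ (v ≢ at ℓ) λ v≢ →
        t ≡ first (excursion v v≢) ⊎ t ≡ last (excursion v v≢)
      cover t t<ℓ with treeDart (walk-∈ t)
      ... | inj₁ (u≢ , w≡) = at t , ≢ℓ , inj₂ (excursion-last (at t) ≢ℓ t<ℓ (cong (at t ,_) w≡))
        where
        ≢ℓ : at t ≢ at ℓ
        ≢ℓ e = u≢ (trans e ℓ-root)
      ... | inj₂ (w≢ , u≡) = at (suc t) , ≢ℓ , inj₁ (excursion-first (at (suc t)) ≢ℓ t<ℓ (cong (_, at (suc t)) u≡))
        where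
        ≢ℓ : at (suc t) ≢ at ℓ
        ≢ℓ e = w≢ (trans e ℓ-root)

-- The bijection

L≡2*[n∸1] : ∀ n → L n ≡ 2 * (n ∸ 1)
L≡2*[n∸1] n = sym (ℕP.*-distribˡ-∸ 2 n 1)

0<L : ∀ {n} → 2 ≤ n → 0 < L n
0<L {n} 2≤n = ℕP.m<n⇒0<n∸m (ℕP.≤-trans (s≤s (s≤s (s≤s z≤n))) (ℕP.*-monoʳ-≤ 2 2≤n))

stepRefl-isRefl : ∀ {n} {x y : Fin n} → x ≢ y → IsRefl n (stepRefl n x y)
stepRefl-isRefl {n} {x} {y} x≢y c = x≢y (label-injective (cong-trans (cong-sym (stepRefl-source x y))
  (cong-trans (congr c) (cong-reflexive (stepRefl-target x y)))))

-- From trees to factorizations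

module _ {n : ℕ} (T : PlaneTree n) (2≤n : 2 ≤ n) where

  open Walk T
  open PlaneTree T

  0<ℓ : 0 < ℓ
  0<ℓ = subst (0 <_) (L≡2*[n∸1] n) (0<L 2≤n)

  factor : ℕ → Pair
  factor t = stepRefl n (at t) (at (suc t))

  lookup-rT : ∀ i → lookup (rT T) i ≡ factor (toℕ i)
  lookup-rT = Vec.lookup∘tabulate _

  factor-pair : ∀ t → factor t ≡ (proj₁ (factor t) , label (at (suc t)))
  factor-pair t = cong (proj₁ (factor t) ,_) (stepRefl-target (at t) (at (suc t)))

  factor-step : ∀ t → Step (factor t) (at t) (at (suc t)) (dist (at t) (at (suc t)))
  factor-step t = stepRefl-step (at t) (at (suc t)) (at-loopless 0<ℓ t)

  rT-isFactorization : FACT n (rT T)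
  rT-isFactorization = ((λ i → subst (IsRefl n) (sym (lookup-rT i)) (factor-isRefl (toℕ i))) , product)
    -- `b` lists the labels met by the walk; `a` lists the same labels, lowered by `n` where the
    -- next label is smaller.
    , (λ t → proj₁ (factor t)) , (λ t → label (at t))
    , (λ i → subst (IsRefl n) (factor-pair (toℕ i)) (factor-isRefl (toℕ i))
           , (λ k → cong (λ r → act n r k) (trans (lookup-rT i) (factor-pair (toℕ i))))
           , subst (proj₁ (factor (toℕ i)) ℤ.<_) (stepRefl-target (at (toℕ i)) (at (suc (toℕ i))))
               (stepRefl-< (at (toℕ i)) (at (suc (toℕ i)))))
    , λ t _ _ → raw (stepRefl-source (at t) (at (suc t)))
    where
    factor-isRefl : ∀ t → IsRefl n (factor t)
    factor-isRefl t = stepRefl-isRefl (at-loopless 0<ℓ t)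
    tour = walk-tour 0<ℓ
    d : ℕ → ℕ
    d t = dist (at t) (at (suc t))
    product : ∀ k → prod n (rT T) k ≡ lam n k
    product k = trans
      (Token.prod-comp at ℓ (λ t _ → at-loopless 0<ℓ t) factor d (λ t _ → factor-step t) (rT T) 0
        (λ i z → cong (λ r → act n r z) (trans (lookup-rT i) (cong factor (sym (ℕP.+-identityʳ (toℕ i)))))) k)
      (trans (cong (λ m → Token.comp at ℓ (λ t _ → at-loopless 0<ℓ t) factor d (λ t _ → factor-step t) m 0 k) (L≡2*[n∸1] n))
        (Factorization.tour⇒fact root rootIsN ℓ refl at factor d tour (λ t _ → factor-step t)
          (λ t _ → dist<n (at t) (at (suc t)) (at-loopless 0<ℓ t)) refl k))

-- Equivalent trees and injectivity

module _ {n : ℕ} (T T′ : PlaneTree n) where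

  open PlaneTree
  private
    module W = Walk T
    module W′ = Walk T′

  root-≡ : root T ≡ root T′
  root-≡ = FinP.toℕ-injective (ℕP.suc-injective (trans (rootIsN T) (sym (rootIsN T′))))

  walk-resp-∼ : T ∼ T′ → ∀ t → W.walk t ≡ W′.walk t
  walk-resp-∼ (rot , mark-≡) zero = cong₂ _,_ root-≡ mark-≡
  walk-resp-∼ eq@(rot , _) (suc t) = trans
    (cong (W.at (suc t) ,_) (nextCW-rotation _ _ (nodup T (W.at (suc t))) (rot (W.at (suc t))) (symm T _ _ (W.walk-∈ t))))
    (cong (λ (u , w) → w , nextCW (ρ T′ w) u) (walk-resp-∼ eq t))

  rT-resp-∼ : T ∼ T′ → rT T ≋[ n ] rT T′
  rT-resp-∼ eq = tabulate⁺ λ i k → cong (λ (u , w) → act n (stepRefl n u w) k) (walk-resp-∼ eq (toℕ i))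

  -- Shifts are positive, so a reflection also tells in which direction its edge is crossed. This
  -- recovers the walk, and as the walk passes every dart, the cyclic order at each vertex.
  rT-injective : 2 ≤ n → rT T ≋[ n ] rT T′ → T ∼ T′
  rT-injective 2≤n eq = rotations , cong proj₂ (walk-≡ z≤n)
    where
    walk-≡-< : ∀ {t} → t < W.ℓ → W.walk t ≡ W′.walk t
    walk-≡-< {t} t<ℓ = subst (λ s → W.walk s ≡ W′.walk s) (FinP.toℕ-fromℕ< t<L)
      (let x , y = step-unique (factor-step T 2≤n s)
             (step-resp-≈ {r = factor T 2≤n s} {s = factor T′ 2≤n s} (tabulate⁻ eq (fromℕ< t<L)) (factor-step T′ 2≤n s))
       in cong₂ _,_ x y)
      where
      t<L : t < L n
      t<L = subst (t <_) (sym (L≡2*[n∸1] n)) t<ℓ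
      s = toℕ (fromℕ< t<L)
    walk-≡ : ∀ {t} → t ≤ W.ℓ → W.walk t ≡ W′.walk t
    walk-≡ t≤ℓ with ℕP.m≤n⇒m<n∨m≡n t≤ℓ
    ... | inj₁ t<ℓ = walk-≡-< t<ℓ
    -- The turn after the last dart shows only at time `ℓ`, when both walks are back at the start.
    ... | inj₂ refl = trans W.walk-closed (trans (walk-≡-< (0<ℓ T 2≤n)) (sym W′.walk-closed))
    rotations : ∀ v → IsRotation (ρ T v) (ρ T′ v)
    rotations v = nextCW⇒rotation (ρ T v) (ρ T′ v) (nodup T v) (nodup T′ v)
      (λ p∈ → let t , t<ℓ , e = W.dart-time (0<ℓ T 2≤n) p∈
                  e′ = trans (sym (walk-≡ (ℕP.<⇒≤ t<ℓ))) e
              in subst (λ (u , w) → w ∈ ρ T′ u) e′ (W′.walk-∈ t))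
      (λ p∈ → let t , t<ℓ , e = W′.dart-time (0<ℓ T 2≤n) p∈
                  e′ = trans (walk-≡ (ℕP.<⇒≤ t<ℓ)) e
              in subst (λ (u , w) → w ∈ ρ T u) e′ (W.walk-∈ t))
      (λ p∈ → let t , t<ℓ , e = W.dart-time (0<ℓ T 2≤n) (symm T _ _ p∈)
                  e′ = trans (sym (walk-≡ (ℕP.<⇒≤ t<ℓ))) e
              in trans (cong (λ (u , w) → nextCW (ρ T w) u) (sym e))
                   (trans (cong proj₂ (walk-≡ t<ℓ)) (cong (λ (u , w) → nextCW (ρ T′ w) u) e′)))

-- From factorizations to trees

module Reconstruction {n : ℕ} (2≤n : 2 ≤ n) (rs : Vec Pair (L n)) (isFact : FACT n rs) where

  a b : ℕ → ℤ
  a = proj₁ (proj₂ isFact)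
  b = proj₁ (proj₂ (proj₂ isFact))

  0<n : 0 < n
  0<n = ℕP.<⇒≤ 2≤n

  instance
    n≢0 : ℕ.NonZero n
    n≢0 = ℕ.>-nonZero 0<n

  factors : ∀ i → IsRefl n (a (toℕ i) , b (suc (toℕ i))) × lookup rs i ≈ᵣ[ n ] (a (toℕ i) , b (suc (toℕ i)))
    × a (toℕ i) ℤ.< b (suc (toℕ i))
  factors = proj₁ (proj₂ (proj₂ (proj₂ isFact)))

  -- Tree-likeness ties `a` to `b` only from index 1 on; the class of the start therefore comes from
  -- `a 0`, all others from `b`.
  c : ℕ → Fin n
  c zero = proj₁ (class (a 0))
  c (suc t) = proj₁ (class (b (suc t)))

  b-at : ∀ t → At (b (suc t)) (c (suc t))
  b-at t = proj₂ (class (b (suc t)))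

  a-at : ∀ t → t < L n → At (a t) (c t)
  a-at zero _ = proj₂ (class (a 0))
  a-at (suc t) t<L = cong-trans (congr (proj₂ (proj₂ (proj₂ (proj₂ isFact))) (suc t) (s≤s z≤n)
    (subst (suc t ≤_) (ℕP.pred[m∸n]≡m∸[1+n] (2 * n) 2) (ℕP.pred-mono-≤ t<L)))) (b-at t)

  factor-at : ∀ t → t < L n → ¬ Cong n (a t) (b (suc t)) × a t ℤ.< b (suc t)
  factor-at t t<L = subst (λ s → ¬ Cong n (a s) (b (suc s)) × a s ℤ.< b (suc s)) (FinP.toℕ-fromℕ< t<L)
    (proj₁ (factors (fromℕ< t<L)) , proj₂ (proj₂ (factors (fromℕ< t<L))))

  R : ℕ → Pair
  R t = a t , b (suc t)

  d : ℕ → ℕ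
  d t = ∣ b (suc t) ℤ.- a t ∣

  loopless : ∀ t → t < L n → c t ≢ c (suc t)
  loopless t t<L e = proj₁ (factor-at t t<L) (raw (cong-trans (a-at t t<L)
    (cong-trans (cong-reflexive (cong label e)) (cong-sym (b-at t)))))

  steps : ∀ t → t < L n → Step (R t) (c t) (c (suc t)) (d t)
  steps t t<L = step-intro (proj₂ (factor-at t t<L)) (a-at t t<L) (b-at t) (loopless t t<L)

  product : ∀ k → Token.comp c (L n) loopless R d steps (L n) 0 k ≡ lam n k
  product k = trans (sym (Token.prod-comp c (L n) loopless R d steps rs 0
    (λ i z → trans (proj₁ (proj₂ (factors i)) z) (cong (λ s → act n (R s) z) (sym (ℕP.+-identityʳ (toℕ i))))) k))
    (proj₂ (proj₁ isFact) k)

  n∸1<n : n ∸ 1 < n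
  n∸1<n = ℕP.≤-reflexive (ℕP.m+[n∸m]≡n 0<n)

  r : Fin n
  r = fromℕ< n∸1<n

  rootN : suc (toℕ r) ≡ n
  rootN = trans (cong suc (FinP.toℕ-fromℕ< n∸1<n)) (ℕP.m+[n∸m]≡n 0<n)

  tour : Touring.Tour c (L n)
  tour = Factorization.fact⇒tour r rootN (L n) (L≡2*[n∸1] n) c R d loopless steps product

  open Touring.FromTour c (L n) tour

  rootN-c : suc (toℕ (c 0)) ≡ n
  rootN-c = trans (cong (suc ∘ toℕ) (Factorization.start-root r rootN (L n) (L≡2*[n∸1] n) c R d loopless steps product)) rootN

  treeOf : PlaneTree n
  treeOf = tree (0<L 2≤n) (L≡2*[n∸1] n) rootN-c

  rT-treeOf : rT treeOf ≋[ n ] rs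
  rT-treeOf = subst (λ ss → rT treeOf ≋[ n ] ss) (Vec.tabulate∘lookup rs)
    (tabulate⁺ λ i k → trans
      (cong (λ (u , w) → act n (stepRefl n u w) k) (tree-walk (0<L 2≤n) (L≡2*[n∸1] n) rootN-c (toℕ i) (FinP.toℕ<n i)))
      (trans (step-≗ (same (toℕ i) (FinP.toℕ<n i)) (steps (toℕ i) (FinP.toℕ<n i)) k) (sym (proj₁ (proj₂ (factors i)) k))))
    where
    -- Both steps join the same classes with shifts below `n`, so the shifts agree.
    same : ∀ t → t < L n → Step (stepRefl n (c t) (c (suc t))) (c t) (c (suc t)) (d t)
    same t t<L = subst (Step (stepRefl n (c t) (c (suc t))) (c t) (c (suc t)))
      (d-unique s (steps t t<L) (dist<n _ _ (loopless t t<L))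
        (Factorization.d<n r rootN (L n) (L≡2*[n∸1] n) c R d loopless steps product t t<L)) s
      where
      s = stepRefl-step (c t) (c (suc t)) (loopless t t<L)

theorem3p10 : (n : ℕ) → 2 ≤ n →
    ((T : PlaneTree n) → FACT n (rT T))
    × ((T T' : PlaneTree n) → T ∼ T' → rT T ≋[ n ] rT T')
    × ((T T' : PlaneTree n) → rT T ≋[ n ] rT T' → T ∼ T')
    × ((rs : Vec Pair (L n)) → FACT n rs → Σ (PlaneTree n) (λ T → rT T ≋[ n ] rs))
theorem3p10 n 2≤n =
    (λ T → rT-isFactorization T 2≤n)
  , rT-resp-∼
  , (λ T T′ → rT-injective T T′ 2≤n)
  , λ rs isFact → let open Reconstruction 2≤n rs isFact in treeOf , rT-treeOf
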